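{- For any graph $G$ of order $n$: (a) $\lambda(M(G))\leq 2n$ if and only if $i_4(\overline{G})\leq 4$; (b) for every positive integer $r$, $\lambda(M(G))=2n+r$ if and only if $\lceil i_4(\overline{G})/2\rceil=r+2$.
   Context: Graphs are finite, simple, undirected; $\overline{G}$ is the complement of $G$. An $L(2,1)$-labeling of $G$ is a map $f:V\to\{0,1,2,\dots\}$ with $|f(x)-f(y)|\ge 2$ if $d_G(x,y)=1$ and $|f(x)-f(y)|\ge1$ if $d_G(x,y)=2$; $\lambda(G)$ is the minimum over such $f$ of the largest label. For $V=\{v_1,\dots,v_n\}$, $M(G)$ has vertex set $V\cup\{v_1',\dots,v_n'\}\cup\{u\}$ and edge set $E\cup\{v_iv_j' : v_iv_j\in E\}\cup\{v_i'u\}$. A 4-star matching of a graph $H$ is a subgraph each of whose components is isomorphic to $K_{1,i}$ for some $1\le i\le 4$; $s_4(H)$ is the maximum order of a 4-star matching of $H$ and $i_4(H)=|V(H)|-s_4(H)$. -}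

module Defs where

open import Data.Nat using (ℕ; _≤_; _+_; _∸_; ∣_-_∣; ⌈_/2⌉)
open import Data.Bool using (Bool; true; false; not; _∧_)
open import Data.Fin using (Fin; _≟_)
open import Data.Sum using (_⊎_; inj₁; inj₂)
open import Data.Unit using (⊤; tt)
open import Data.Product using (Σ; _×_; _,_; ∃)
open import Data.List using (List; []; _∷_; length; concatMap)
open import Data.List.Relation.Unary.All using (All)
open import Data.List.Relation.Unary.Unique.Propositional using (Unique)
open import Relation.Binary.PropositionalEquality using (_≡_; _≢_; refl) renaming (sym to ≡-sym)
open import Relation.Nullary.Decidable using (⌊_⌋; yes; no)
open import Data.Empty using (⊥-elim)
open import Data.Bool.Properties using (∧-zeroʳ)

record Graph (V : Set) : Set where
  field
    adj    : V → V → Bool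
    sym    : ∀ x y → adj x y ≡ adj y x
    irrefl : ∀ x → adj x x ≡ false
open Graph public

compl : {n : ℕ} → Graph (Fin n) → Graph (Fin n)
compl {n} G = record { adj = a ; sym = s ; irrefl = i }
  where
  a : Fin n → Fin n → Bool
  a x y = not (adj G x y) ∧ not ⌊ x ≟ y ⌋
  eqsym : ∀ x y → ⌊ x ≟ y ⌋ ≡ ⌊ y ≟ x ⌋
  eqsym x y with x ≟ y | y ≟ x
  ... | yes _ | yes _ = refl
  ... | no _ | no _ = refl
  ... | yes p | no q = ⊥-elim (q (≡-sym p))
  ... | no p | yes q = ⊥-elim (p (≡-sym q))
  s : ∀ x y → a x y ≡ a y x
  s x y rewrite sym G x y | eqsym x y = refl
  i : ∀ x → a x x ≡ false
  i x with x ≟ x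
  ... | yes _ = ∧-zeroʳ (not (adj G x x))
  ... | no p = ⊥-elim (p refl)

-- Vertices of M(G): inj₁ i = v_i, inj₂ (inj₁ i) = v_i', inj₂ (inj₂ tt) = u.
MV : ℕ → Set
MV n = Fin n ⊎ (Fin n ⊎ ⊤)

M : {n : ℕ} → Graph (Fin n) → Graph (MV n)
M {n} G = record { adj = a ; sym = s ; irrefl = i }
  where
  a : MV n → MV n → Bool
  a (inj₁ x) (inj₁ y) = adj G x y
  a (inj₁ x) (inj₂ (inj₁ y)) = adj G x y
  a (inj₂ (inj₁ y)) (inj₁ x) = adj G x y
  a (inj₂ (inj₁ _)) (inj₂ (inj₂ tt)) = true
  a (inj₂ (inj₂ tt)) (inj₂ (inj₁ _)) = true
  a _ _ = false
  s : ∀ x y → a x y ≡ a y x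
  s (inj₁ x) (inj₁ y) = sym G x y
  s (inj₁ x) (inj₂ (inj₁ y)) = refl
  s (inj₁ x) (inj₂ (inj₂ tt)) = refl
  s (inj₂ (inj₁ y)) (inj₁ x) = refl
  s (inj₂ (inj₁ x)) (inj₂ (inj₁ y)) = refl
  s (inj₂ (inj₁ _)) (inj₂ (inj₂ tt)) = refl
  s (inj₂ (inj₂ tt)) (inj₁ _) = refl
  s (inj₂ (inj₂ tt)) (inj₂ (inj₁ _)) = refl
  s (inj₂ (inj₂ tt)) (inj₂ (inj₂ tt)) = refl
  i : ∀ x → a x x ≡ false
  i (inj₁ x) = irrefl G x
  i (inj₂ (inj₁ x)) = refl
  i (inj₂ (inj₂ tt)) = refl

Dist1 : {V : Set} → Graph V → V → V → Set
Dist1 G x y = adj G x y ≡ true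

Dist2 : {V : Set} → Graph V → V → V → Set
Dist2 G x y = x ≢ y × adj G x y ≡ false × ∃ λ z → adj G x z ≡ true × adj G z y ≡ true

IsL21 : {V : Set} → Graph V → (V → ℕ) → Set
IsL21 G f = (∀ x y → Dist1 G x y → 2 ≤ ∣ f x - f y ∣)
          × (∀ x y → Dist2 G x y → f x ≢ f y)

-- There is an L(2,1)-labeling whose largest label is at most k  (i.e. λ(G) ≤ k).
HasSpan : {V : Set} → Graph V → ℕ → Set
HasSpan G k = Σ _ λ f → IsL21 G f × (∀ x → f x ≤ k)

IsLambda : {V : Set} → Graph V → ℕ → Set
IsLambda G k = HasSpan G k × (∀ m → HasSpan G m → k ≤ m)

record Star {n : ℕ} (H : Graph (Fin n)) : Set where
  field
    center  : Fin n
    leaves  : List (Fin n)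
    atLeast : 1 ≤ length leaves
    atMost  : length leaves ≤ 4
    edges   : All (λ l → adj H center l ≡ true) leaves
open Star public

starVerts : {n : ℕ} {H : Graph (Fin n)} → Star H → List (Fin n)
starVerts s = center s ∷ leaves s

FourStarMatching : {n : ℕ} → Graph (Fin n) → Set
FourStarMatching H = Σ (List (Star H)) λ ss → Unique (concatMap starVerts ss)

order : {n : ℕ} {H : Graph (Fin n)} → FourStarMatching H → ℕ
order (ss , _) = length (concatMap starVerts ss)

IsS4 : {n : ℕ} → Graph (Fin n) → ℕ → Set
IsS4 H s = (Σ (FourStarMatching H) λ m → order m ≡ s)
         × (∀ (m : FourStarMatching H) → order m ≤ s)

{-# OPTIONS --safe #-}

-- Both directions go through injective labelings. If vertices y, z share a label, they have no
-- common neighbour; hence any vertex can stand next to y or next to z, and either y or z fits into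
-- an unused label, or reversing the labels between that label and theirs makes room for one of
-- them. So a labeling with at least as many labels as vertices can be made injective without
-- increasing its span.
--
-- For an injective labeling of M(G) with labels 0, …, 2n + r, join x and y when some label of x is
-- consecutive to some label of y and the two labels are not both on copies v'. These are edges of
-- the complement, every degree is at most 4 (two labels per vertex, two sides per label). For an
-- isolated x, at most one side of the label of v_x carries v_x', so another one is the end of the
-- range, the label of u, or an unused label; there are 2r + 4 such sides in total. A graph of
-- maximum degree at most 4 has a star forest covering its nonisolated vertices, and its stars have
-- at most 4 leaves.
--
-- Conversely, a star with centre x and leaves l₁, …, l₄ occupies consecutive labels as
-- l₁' l₁ x l₂ l₂' l₃' l₃ x' l₄ l₄' (similarly for fewer leaves), while the unmatched vertices
-- w₀, w₁, … are placed as w₀ w₀' [stars] w₁' w₁ u w₂ w₂' w₃' w₃ _ w₄ w₄' w₅' w₅ _ ….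
module Submission where

open import Defs
open import Data.Bool using (true; false)
import Data.Bool.Properties as Bool
open import Data.Empty using (⊥; ⊥-elim)
open import Data.Fin using (Fin; _≟_)
import Data.Fin.Properties as Fin
open import Data.List using (List; []; _∷_; _++_; length; filter; map; allFin; upTo; concatMap)
open import Data.List.Membership.Propositional using (_∈_; lose; find)
open import Data.List.Membership.Propositional.Properties
import Data.List.Membership.DecPropositional as DecMembership
open import Data.List.Properties using (length-++; length-map; length-tabulate; length-upTo; ++-identityʳ)
open import Data.List.Relation.Unary.All as All using (All; []; _∷_; all?)
import Data.List.Relation.Unary.All.Properties as All
open import Data.List.Relation.Unary.AllPairs using ([]; _∷_)
open import Data.List.Relation.Unary.Any as Any using (Any; here; there; any?)
open import Data.List.Relation.Unary.Unique.Propositional using (Unique)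
import Data.List.Relation.Unary.Unique.Propositional.Properties as Unique
import Data.List.Relation.Unary.Unique.DecPropositional as DecUnique
open import Data.Maybe using (Maybe; just; nothing)
open import Data.Nat using (ℕ; zero; suc; _≤_; _<_; _+_; _*_; _∸_; ⌈_/2⌉; ∣_-_∣; z≤n; s≤s)
open import Data.Nat.Properties hiding (_≟_)
import Data.Nat.Properties as ℕ
open import Data.Nat.Solver using (module +-*-Solver)
open import Data.Product using (Σ; ∃; _×_; _,_; proj₁; proj₂)
open import Data.Sum using (_⊎_; inj₁; inj₂; [_,_]′)
open import Data.Sum.Properties as Sum using (inj₁-injective; inj₂-injective)
open import Data.Unit using (⊤; tt)
import Data.Unit.Properties as Unit
open import Function using (_∘_; id; case_of_)
open import Function.Bundles using (_⇔_; mk⇔)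
open import Relation.Binary.Definitions using (DecidableEquality)
open import Relation.Binary.PropositionalEquality using (_≡_; _≢_; refl; trans; cong; cong₂; subst) renaming (sym to ≡-sym)
open import Relation.Nullary using (¬_; Dec; yes; no)
open import Relation.Nullary.Decidable using (map′; _×-dec_; _⊎-dec_; _→-dec_; ¬?)

-- Counting by injective relations.

remove : {B : Set} {P : B → Set} {ys : List B} → Any P ys → List B
remove {ys = _ ∷ ys} (here _)  = ys
remove {ys = y ∷ _}  (there p) = y ∷ remove p

length-remove : {B : Set} {P : B → Set} {ys : List B} (p : Any P ys) → length ys ≡ suc (length (remove p))
length-remove (here _)  = refl
length-remove (there p) = cong suc (length-remove p)

remove-other : {B : Set} {P Q : B → Set} {ys : List B} (p : Any P ys) → (∀ {y} → P y → Q y → ⊥) → Any Q ys → Any Q (remove p)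
remove-other (here p)  d (here q)  = ⊥-elim (d p q)
remove-other (here p)  d (there q) = q
remove-other (there p) d (here q)  = here q
remove-other (there p) d (there q) = there (remove-other p d q)

-- Each `x` deletes one matching position of `ys`; the later elements keep their matches because no
-- entry is related to two elements. Hence `ys` may contain repetitions.
pigeonhole : {A B : Set} (R : A → B → Set) → (∀ {a a' b} → R a b → R a' b → a ≡ a') →
  (xs : List A) (ys : List B) → Unique xs → (∀ {x} → x ∈ xs → Any (R x) ys) → length xs ≤ length ys
pigeonhole R inj [] ys _ _ = z≤n
pigeonhole R inj (x ∷ xs) ys (x∉ ∷ u) f = subst (suc (length xs) ≤_) (≡-sym (length-remove p))
  (s≤s (pigeonhole R inj xs (remove p) u
    λ y∈ → remove-other p (λ a b → All.lookup x∉ y∈ (inj a b)) (f (there y∈))))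
  where p = f (here refl)

unique-⊆-length : {A : Set} {xs ys : List A} → Unique xs → (∀ {x} → x ∈ xs → x ∈ ys) → length xs ≤ length ys
unique-⊆-length {xs = xs} {ys} = pigeonhole _≡_ (λ p q → trans p (≡-sym q)) xs ys

-- Labels at distance at most one.

Near : ℕ → ℕ → Set
Near i j = i ≡ j ⊎ suc i ≡ j ⊎ i ≡ suc j

near-sym : ∀ {i j} → Near i j → Near j i
near-sym (inj₁ e)        = inj₁ (≡-sym e)
near-sym (inj₂ (inj₁ e)) = inj₂ (inj₂ (≡-sym e))
near-sym (inj₂ (inj₂ e)) = inj₂ (inj₁ (≡-sym e))

near-suc : ∀ {i j} → Near i j → Near (suc i) (suc j)
near-suc (inj₁ e)        = inj₁ (cong suc e)
near-suc (inj₂ (inj₁ e)) = inj₂ (inj₁ (cong suc e))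
near-suc (inj₂ (inj₂ e)) = inj₂ (inj₂ (cong suc e))

¬near⇒far : ∀ i j → ¬ Near i j → 2 ≤ ∣ i - j ∣
¬near⇒far zero zero n = ⊥-elim (n (inj₁ refl))
¬near⇒far zero (suc zero) n = ⊥-elim (n (inj₂ (inj₁ refl)))
¬near⇒far zero (suc (suc j)) n = s≤s (s≤s z≤n)
¬near⇒far (suc zero) zero n = ⊥-elim (n (inj₂ (inj₂ refl)))
¬near⇒far (suc (suc i)) zero n = s≤s (s≤s z≤n)
¬near⇒far (suc i) (suc j) n = ¬near⇒far i j (n ∘ near-suc)

far⇒¬near : ∀ i j → 2 ≤ ∣ i - j ∣ → ¬ Near i j
far⇒¬near zero zero () _
far⇒¬near zero (suc j) f (inj₂ (inj₁ refl)) = case f of λ { (s≤s ()) }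
far⇒¬near (suc i) zero f (inj₂ (inj₂ refl)) = case f of λ { (s≤s ()) }
far⇒¬near (suc i) (suc j) f (inj₁ e) = far⇒¬near i j f (inj₁ (suc-injective e))
far⇒¬near (suc i) (suc j) f (inj₂ (inj₁ e)) = far⇒¬near i j f (inj₂ (inj₁ (suc-injective e)))
far⇒¬near (suc i) (suc j) f (inj₂ (inj₂ e)) = far⇒¬near i j f (inj₂ (inj₂ (suc-injective e)))

module Reversal (ℓ h : ℕ) (ℓ<h : ℓ < h) where

  Inside : ℕ → Set
  Inside i = ℓ < i × i < h

  inside? : ∀ i → Dec (Inside i)
  inside? i = (ℓ <? i) ×-dec (i <? h)

  reflect : ℕ → ℕ
  reflect i with inside? i
  ... | yes _ = ℓ + h ∸ i
  ... | no  _ = i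

  -- A view of `reflect` that pins down the image by a sum, so that no truncated subtraction enters
  -- the case analyses.
  data Reflects (i a : ℕ) : Set where
    inside : Inside i → a + i ≡ ℓ + h → Inside a → Reflects i a
    below  : i ≤ ℓ → a ≡ i → Reflects i a
    above  : h ≤ i → a ≡ i → Reflects i a

  reflects : ∀ i → Reflects i (reflect i)
  reflects i with inside? i
  ... | yes (ℓ<i , i<h) = inside (ℓ<i , i<h) eq (ℓ<a , a<h)
    where
    a = ℓ + h ∸ i
    eq : a + i ≡ ℓ + h
    eq = m∸n+n≡m (≤-trans (<⇒≤ i<h) (m≤n+m h ℓ))
    ℓ<a : ℓ < a
    ℓ<a = +-cancelʳ-< i ℓ a (subst (ℓ + i <_) (≡-sym eq) (+-monoʳ-< ℓ i<h))
    a<h : a < h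
    a<h = +-cancelʳ-< i a h (subst (_< h + i) (≡-sym eq) (subst (_< h + i) (+-comm h ℓ) (+-monoʳ-< h ℓ<i)))
  ... | no ¬in with ℓ <? i
  ...   | no ℓ≮i = below (≮⇒≥ ℓ≮i) refl
  ...   | yes ℓ<i = above (≮⇒≥ λ i<h → ¬in (ℓ<i , i<h)) refl

  reflect-≤ : ∀ {i k} → i ≤ k → h ≤ k → reflect i ≤ k
  reflect-≤ {i} i≤k h≤k with reflect i | reflects i
  ... | a | inside _ _ (_ , a<h) = <⇒≤ (<-≤-trans a<h h≤k)
  ... | a | below _ refl = i≤k
  ... | a | above _ refl = i≤k

  reflect-injective : ∀ {i j} → reflect i ≡ reflect j → i ≡ j
  reflect-injective {i} {j} e with reflect i | reflects i | reflect j | reflects j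
  reflect-injective refl | a | inside _ p _ | .a | inside _ q _ = +-cancelˡ-≡ a _ _ (trans p (≡-sym q))
  reflect-injective refl | a | inside _ _ (ℓ<a , _) | .a | below j≤ℓ refl = ⊥-elim (<⇒≱ ℓ<a j≤ℓ)
  reflect-injective refl | a | inside _ _ (_ , a<h) | .a | above h≤j refl = ⊥-elim (<⇒≱ a<h h≤j)
  reflect-injective refl | a | below a≤ℓ refl | .a | inside _ _ (ℓ<a , _) = ⊥-elim (<⇒≱ ℓ<a a≤ℓ)
  reflect-injective refl | a | above h≤a refl | .a | inside _ _ (_ , a<h) = ⊥-elim (<⇒≱ a<h h≤a)
  reflect-injective refl | a | below _ refl | .a | below _ refl = refl
  reflect-injective refl | a | below _ refl | .a | above _ refl = refl
  reflect-injective refl | a | above _ refl | .a | below _ refl = refl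
  reflect-injective refl | a | above _ refl | .a | above _ refl = refl

  reflect-≢ : ∀ {j} → j ≢ h → reflect j ≢ h
  reflect-≢ {j} j≢h e with reflect j | reflects j
  ... | a | inside _ _ (_ , a<h) = <⇒≢ a<h e
  ... | a | below _ refl = j≢h e
  ... | a | above _ refl = j≢h e

  -- The only nearness that the reversal creates between labels other than `h`: the label `h - 1` is
  -- carried to `ℓ + 1`, next to the fixed label `ℓ`.
  NewPair : ℕ → ℕ → Set
  NewPair i j = i ≡ ℓ × suc j ≡ h

  private
    mixed : ∀ {i a j b} → Inside i → a + i ≡ ℓ + h → Inside a → (j ≤ ℓ ⊎ h ≤ j) → b ≡ j → j ≢ h →
      Near a b → NewPair j i
    mixed _ _ (ℓ<a , _) (inj₁ j≤ℓ) refl _ (inj₁ refl) = ⊥-elim (<⇒≱ ℓ<a j≤ℓ)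
    mixed _ _ (ℓ<a , _) (inj₁ j≤ℓ) refl _ (inj₂ (inj₁ refl)) = ⊥-elim (<⇒≱ ℓ<a (≤-trans (n≤1+n _) j≤ℓ))
    -- Here `a` is `suc j` with `j ≤ ℓ < a`, so `j` is `ℓ`, and the sum then forces `suc i ≡ h`.
    mixed {i} {j = j} _ eq (s≤s ℓ≤j , _) (inj₁ j≤ℓ) refl _ (inj₂ (inj₂ refl)) with ≤-antisym j≤ℓ ℓ≤j
    ... | refl = refl , +-cancelˡ-≡ j _ _ (trans (+-suc j i) eq)
    mixed _ _ (_ , a<h) (inj₂ h≤j) refl _ (inj₁ refl) = ⊥-elim (<⇒≱ a<h h≤j)
    mixed _ _ (_ , a<h) (inj₂ h≤j) refl j≢h (inj₂ (inj₁ refl)) = ⊥-elim (j≢h (≤-antisym a<h h≤j))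
    mixed _ _ (_ , a<h) (inj₂ h≤j) refl _ (inj₂ (inj₂ refl)) = ⊥-elim (<⇒≱ a<h (≤-trans h≤j (n≤1+n _)))

  reflect-near : ∀ {i j} → i ≢ h → j ≢ h → Near (reflect i) (reflect j) →
    Near i j ⊎ NewPair i j ⊎ NewPair j i
  reflect-near {i} {j} i≢h j≢h nr with reflect i | reflects i | reflect j | reflects j
  ... | a | inside _ p _ | b | inside _ q _ = inj₁ (go nr)
    where
    go : Near a b → Near i j
    go (inj₁ refl) = inj₁ (+-cancelˡ-≡ a _ _ (trans p (≡-sym q)))
    go (inj₂ (inj₁ refl)) = inj₂ (inj₂ (+-cancelˡ-≡ a _ _ (trans p (trans (≡-sym q) (≡-sym (+-suc a j))))))
    go (inj₂ (inj₂ refl)) = inj₂ (inj₁ (+-cancelˡ-≡ b _ _ (trans (+-suc b i) (trans p (≡-sym q)))))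
  ... | a | inside x p y | b | below l e = inj₂ (inj₂ (mixed x p y (inj₁ l) e j≢h nr))
  ... | a | inside x p y | b | above l e = inj₂ (inj₂ (mixed x p y (inj₂ l) e j≢h nr))
  ... | a | below l e | b | inside x p y = inj₂ (inj₁ (mixed x p y (inj₁ l) e i≢h (near-sym nr)))
  ... | a | above l e | b | inside x p y = inj₂ (inj₁ (mixed x p y (inj₂ l) e i≢h (near-sym nr)))
  ... | a | below _ refl | b | below _ refl = inj₁ nr
  ... | a | below _ refl | b | above _ refl = inj₁ nr
  ... | a | above _ refl | b | below _ refl = inj₁ nr
  ... | a | above _ refl | b | above _ refl = inj₁ nr

  -- Just below `h` now lies the former `ℓ + 1`, or `ℓ` itself if `h` is `ℓ + 1`. So a vertex moved
  -- from `ℓ` to `h` meets only labels that were already near its own, and `h + 1`.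
  hole-near : ∀ {j} → j ≢ h → Near h (reflect j) → Near ℓ j ⊎ j ≡ suc h
  hole-near {j} j≢h nr with reflect j | reflects j
  hole-near j≢h (inj₁ refl) | b | inside _ _ (_ , b<h) = ⊥-elim (<-irrefl refl b<h)
  hole-near j≢h (inj₂ (inj₁ refl)) | b | inside _ _ (_ , b<h) = ⊥-elim (<⇒≱ b<h (n≤1+n _))
  hole-near {j} j≢h (inj₂ (inj₂ refl)) | b | inside _ eq _ =
    inj₁ (inj₂ (inj₁ (≡-sym (+-cancelˡ-≡ b _ _ (trans eq (trans (+-comm ℓ (suc b)) (≡-sym (+-suc b ℓ))))))))
  hole-near j≢h (inj₁ refl) | b | below j≤ℓ refl = ⊥-elim (j≢h refl)
  hole-near j≢h (inj₂ (inj₁ refl)) | b | below j≤ℓ refl = ⊥-elim (<⇒≱ ℓ<h (≤-trans (n≤1+n _) j≤ℓ))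
  hole-near j≢h (inj₂ (inj₂ refl)) | b | below j≤ℓ refl = inj₁ (inj₁ (≤-antisym (≤-pred ℓ<h) j≤ℓ))
  hole-near j≢h (inj₁ refl) | b | above h≤j refl = ⊥-elim (j≢h refl)
  hole-near j≢h (inj₂ (inj₁ refl)) | b | above h≤j refl = inj₂ refl
  hole-near j≢h (inj₂ (inj₂ refl)) | b | above h≤j refl = ⊥-elim (<⇒≱ h≤j ≤-refl)

∸-near : ∀ {k i j} → i ≤ k → j ≤ k → suc (k ∸ i) ≡ k ∸ j → i ≡ suc j
∸-near {k} {i} {j} i≤k j≤k e = +-cancelˡ-≡ (k ∸ i) _ _
  (trans (m∸n+n≡m i≤k) (trans (≡-sym (m∸n+n≡m j≤k)) (trans (cong (_+ j) (≡-sym e)) (≡-sym (+-suc _ j)))))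

mirror-near : ∀ {k i j} → i ≤ k → j ≤ k → Near (k ∸ i) (k ∸ j) → Near i j
mirror-near i≤k j≤k (inj₁ e)        = inj₁ (∸-cancelˡ-≡ i≤k j≤k e)
mirror-near i≤k j≤k (inj₂ (inj₁ e)) = inj₂ (inj₂ (∸-near i≤k j≤k e))
mirror-near i≤k j≤k (inj₂ (inj₂ e)) = inj₂ (inj₁ (≡-sym (∸-near j≤k i≤k (≡-sym e))))

-- Injective labelings

-- The L(2,1)-conditions in a form convenient for relabeling: `distinct` concerns all pairs with a
-- common neighbour, since adjacent pairs differ already by `separated`.
record Valid {V : Set} (K : Graph V) (f : V → ℕ) : Set where
  field
    separated : ∀ {a b} → adj K a b ≡ true → ¬ Near (f a) (f b)
    distinct  : ∀ {a b} c → a ≢ b → adj K a c ≡ true → adj K b c ≡ true → f a ≢ f b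
open Valid

L21⇒valid : {V : Set} {K : Graph V} {f : V → ℕ} → IsL21 K f → Valid K f
L21⇒valid {K = K} {f} (d1 , d2) = record
  { separated = λ {a} {b} ab → far⇒¬near _ _ (d1 a b ab)
  ; distinct  = λ {a} {b} c a≢b ac bc e → dist a b c a≢b ac bc e (adj K a b) refl }
  where
  dist : ∀ a b c → a ≢ b → adj K a c ≡ true → adj K b c ≡ true → f a ≡ f b → ∀ t → adj K a b ≡ t → ⊥
  dist a b c a≢b ac bc e true  ab = far⇒¬near _ _ (d1 a b ab) (inj₁ e)
  dist a b c a≢b ac bc e false ab = d2 a b (a≢b , ab , c , ac , trans (sym K c b) bc) e

module Finite {V : Set} {vs : List V} (complete : ∀ v → v ∈ vs) where

  ∀? : {P : V → Set} → (∀ v → Dec (P v)) → Dec (∀ v → P v)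
  ∀? P? = map′ (λ ps v → All.lookup ps (complete v)) (λ p → All.universal p vs) (all? P? vs)

  ∃? : {P : V → Set} → (∀ v → Dec (P v)) → Dec (∃ P)
  ∃? P? = map′ (λ p → proj₁ (find p) , proj₂ (proj₂ (find p))) (λ (v , p) → lose (complete v) p) (any? P? vs)

-- Removing repeated labels.

module Injectivise {V : Set} (_≟V_ : DecidableEquality V) (K : Graph V) (vs : List V) (complete : ∀ v → v ∈ vs)
  (unique : Unique vs) (k : ℕ) (enough : length vs ≤ suc k) where

  open Finite complete

  Bounded : (V → ℕ) → Set
  Bounded f = ∀ v → f v ≤ k

  Adj : V → V → Set
  Adj a b = adj K a b ≡ true

  Adj? : ∀ a b → Dec (Adj a b)
  Adj? a b = adj K a b Bool.≟ true

  adj-sym : ∀ {a b} → Adj a b → Adj b a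
  adj-sym {a} {b} = trans (sym K b a)

  -- The last clause makes the number of colliding vertices drop when `z` collides under `f`: no
  -- collision is new, and `z` takes part in none.
  Improves : (V → ℕ) → V → (V → ℕ) → Set
  Improves f z g = Valid K g × Bounded g × (∀ {a b} → a ≢ b → g a ≡ g b → f a ≡ f b × a ≢ z × b ≢ z)

  -- The common pattern of all moves: `z` goes to the hole `h`, and the other labels are changed by
  -- an injection `ρ` that keeps them off `h`. Equal new labels then stem from equal old ones, so
  -- the condition on common neighbours carries over and only nearness has to be checked.
  relocate : ∀ {f} → Valid K f → ∀ z h → h ≤ k → (∀ v → f v ≢ h) → (ρ : ℕ → ℕ) →
    (∀ {v} → ρ (f v) ≤ k) → (∀ {i j} → ρ i ≡ ρ j → i ≡ j) → (∀ {i} → i ≢ h → ρ i ≢ h) →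
    (∀ {a b} → a ≢ z → b ≢ z → Adj a b → ¬ Near (ρ (f a)) (ρ (f b))) →
    (∀ {b} → Adj z b → ¬ Near h (ρ (f b))) →
    ∃ (Improves f z)
  relocate {f} valid z h h≤k hole ρ ρ≤k ρ-inj ρ≢h sep sepz = g , record { separated = separated' ; distinct = distinct' } , bound , coll
    where
    g : V → ℕ
    g v with v ≟V z
    ... | yes _ = h
    ... | no  _ = ρ (f v)
    bound : Bounded g
    bound v with v ≟V z
    ... | yes _ = h≤k
    ... | no  _ = ρ≤k
    coll : ∀ {a b} → a ≢ b → g a ≡ g b → f a ≡ f b × a ≢ z × b ≢ z
    coll {a} {b} a≢b e with a ≟V z | b ≟V z
    ... | yes refl | yes refl = ⊥-elim (a≢b refl)
    ... | yes refl | no _ = ⊥-elim (ρ≢h (hole b) (≡-sym e))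
    ... | no _ | yes refl = ⊥-elim (ρ≢h (hole a) e)
    ... | no p | no q = ρ-inj e , p , q
    separated' : ∀ {a b} → Adj a b → ¬ Near (g a) (g b)
    separated' {a} {b} ab nr with a ≟V z | b ≟V z
    ... | yes refl | yes refl = case trans (≡-sym ab) (irrefl K a) of λ ()
    ... | yes refl | no _ = sepz ab nr
    ... | no _ | yes refl = sepz (adj-sym ab) (near-sym nr)
    ... | no p | no q = sep p q ab nr
    distinct' : ∀ {a b} c → a ≢ b → Adj a c → Adj b c → g a ≢ g b
    distinct' c a≢b ac bc e = distinct valid c a≢b ac bc (proj₁ (coll a≢b e))

  BlockedBelow BlockedAbove : (V → ℕ) → ℕ → V → Set
  BlockedBelow f h w = ∃ λ p → Adj w p × suc (f p) ≡ h
  BlockedAbove f h w = ∃ λ q → Adj w q × f q ≡ suc h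

  move : ∀ {f} → Valid K f → Bounded f → ∀ {h} → h ≤ k → (∀ v → f v ≢ h) → ∀ z →
    ¬ BlockedBelow f h z → ¬ BlockedAbove f h z → ∃ (Improves f z)
  move {f} valid bound {h} h≤k hole z nb na = relocate valid z h h≤k hole id (bound _) id id (λ _ _ → separated valid) free
    where
    free : ∀ {b} → Adj z b → ¬ Near h (f b)
    free {b} zb (inj₁ e) = hole b (≡-sym e)
    free {b} zb (inj₂ (inj₁ e)) = na (b , zb , ≡-sym e)
    free {b} zb (inj₂ (inj₂ e)) = nb (b , zb , ≡-sym e)

  -- After the reversal, `h` is near only to labels that were near `f z`, and to `h + 1`. The price
  -- is that vertices left on `f z` become consecutive to those formerly on `h - 1`; the last
  -- hypothesis excludes adjacency there.
  reverse-up : ∀ {f} → Valid K f → Bounded f → ∀ {h} → h ≤ k → (∀ v → f v ≢ h) → ∀ z → f z < h →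
    ¬ BlockedAbove f h z → (∀ {a} → a ≢ z → f a ≡ f z → ¬ BlockedBelow f h a) → ∃ (Improves f z)
  reverse-up {f} valid bound {h} h≤k hole z z<h na nb =
    relocate valid z h h≤k hole reflect (reflect-≤ (bound _) h≤k) reflect-injective reflect-≢ sep sepz
    where
    open Reversal (f z) h z<h
    sep : ∀ {a b} → a ≢ z → b ≢ z → Adj a b → ¬ Near (reflect (f a)) (reflect (f b))
    sep {a} {b} a≢z b≢z ab nr with reflect-near (hole a) (hole b) nr
    ... | inj₁ nr' = separated valid ab nr'
    ... | inj₂ (inj₁ (e , e')) = nb a≢z e (b , ab , e')
    ... | inj₂ (inj₂ (e , e')) = nb b≢z e (a , adj-sym ab , e')
    sepz : ∀ {b} → Adj z b → ¬ Near h (reflect (f b))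
    sepz {b} zb nr with hole-near (hole b) nr
    ... | inj₁ nr' = separated valid zb nr'
    ... | inj₂ e = na (b , zb , e)

  -- Obtained from `reverse-up` by replacing each label `i` by `k - i`, which exchanges the two
  -- sides of the hole.
  reverse-down : ∀ {f} → Valid K f → Bounded f → ∀ {h} → h ≤ k → (∀ v → f v ≢ h) → ∀ z → h < f z →
    ¬ BlockedBelow f h z → (∀ {a} → a ≢ z → f a ≡ f z → ¬ BlockedAbove f h a) → ∃ (Improves f z)
  reverse-down {f} valid bound {h} h≤k hole z h<z nb na = g , v , bd , λ a≢b e →
      let (e' , r) = coll a≢b e in ∸-cancelˡ-≡ (bound _) (bound _) e' , r
    where
    f' : V → ℕ
    f' v = k ∸ f v
    valid' : Valid K f'
    valid' = record
      { separated = λ ab nr → separated valid ab (mirror-near (bound _) (bound _) nr)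
      ; distinct = λ c a≢b ac bc e → distinct valid c a≢b ac bc (∸-cancelˡ-≡ (bound _) (bound _) e) }
    r = reverse-up valid' (λ v → m∸n≤m k (f v)) (m∸n≤m k h) (λ v e → hole v (∸-cancelˡ-≡ (bound v) h≤k e)) z
      (∸-monoʳ-< h<z (bound z))
      (λ (q , zq , e) → nb (q , zq , ≡-sym (∸-near h≤k (bound q) (≡-sym e))))
      (λ a≢z e (p , ap , e') → na a≢z (∸-cancelˡ-≡ (bound _) (bound _) e) (p , ap , ∸-near (bound p) h≤k e'))
    g = proj₁ r
    v = proj₁ (proj₂ r)
    bd = proj₁ (proj₂ (proj₂ r))
    coll = proj₂ (proj₂ (proj₂ r))

  blockedBelow? : ∀ f h w → Dec (BlockedBelow f h w)
  blockedBelow? f h w = ∃? λ p → Adj? w p ×-dec (suc (f p) ℕ.≟ h)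

  blockedAbove? : ∀ f h w → Dec (BlockedAbove f h w)
  blockedAbove? f h w = ∃? λ q → Adj? w q ×-dec (f q ℕ.≟ suc h)

  Exclusive : (V → ℕ) → ℕ → (V → Set) → Set
  Exclusive f i B = ∀ {a b} → a ≢ b → f a ≡ i → f b ≡ i → B a → B b → ⊥

  Improvable : (V → ℕ) → Set
  Improvable f = ∃ λ z → (∃ λ y → y ≢ z × f y ≡ f z) × ∃ (Improves f z)

  -- If the shared label lies below `h`, then `z` moves up: as `z` is blocked below, no other vertex
  -- with its label is, which is what the reversal needs. If it lies above `h`, then `y` moves down
  -- for the mirrored reason.
  swap : ∀ {f} → Valid K f → Bounded f → ∀ {h} → h ≤ k → (∀ v → f v ≢ h) → ∀ {y z} → y ≢ z → f y ≡ f z →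
    Exclusive f (f z) (BlockedBelow f h) → Exclusive f (f z) (BlockedAbove f h) →
    BlockedBelow f h z → ¬ BlockedAbove f h z → ¬ BlockedBelow f h y → BlockedAbove f h y → Improvable f
  swap {f} valid bound {h} h≤k hole {y} {z} y≢z yz exB exA b a b' a' with f z <? h
  ... | yes z<h = z , (y , y≢z , yz) ,
    reverse-up valid bound h≤k hole z z<h a (λ c≢z e bc → exB c≢z e refl bc b)
  ... | no z≮h = y , (z , y≢z ∘ ≡-sym , ≡-sym yz) ,
    reverse-down valid bound h≤k hole y (subst (h <_) (≡-sym yz) (≤∧≢⇒< (≮⇒≥ z≮h) (hole z ∘ ≡-sym))) b'
      (λ c≢y e ac → exA c≢y (trans e yz) yz ac a')

  -- A vertex blocked on neither side moves directly; exclusivity leaves only the case in which the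
  -- two are blocked on opposite sides.
  improve : ∀ {f} → Valid K f → Bounded f → ∀ {h} → h ≤ k → (∀ v → f v ≢ h) → ∀ {y z} → y ≢ z → f y ≡ f z →
    Exclusive f (f z) (BlockedBelow f h) → Exclusive f (f z) (BlockedAbove f h) → Improvable f
  improve {f} valid bound {h} h≤k hole {y} {z} y≢z yz exB exA
    with blockedBelow? f h z | blockedAbove? f h z | blockedBelow? f h y | blockedAbove? f h y
  ... | no b | no a | _ | _ = z , (y , y≢z , yz) , move valid bound h≤k hole z b a
  ... | _ | _ | no b | no a = y , (z , y≢z ∘ ≡-sym , ≡-sym yz) , move valid bound h≤k hole y b a
  ... | yes b | _ | yes b' | _ = ⊥-elim (exB y≢z yz refl b' b)
  ... | _ | yes a | _ | yes a' = ⊥-elim (exA y≢z yz refl a' a)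
  ... | yes b | no a | no b' | yes a' = swap valid bound h≤k hole y≢z yz exB exA b a b' a'
  ... | no b | yes a | yes b' | no a' = swap valid bound h≤k hole (y≢z ∘ ≡-sym) (≡-sym yz)
    (λ c≢d ec ed → exB c≢d (trans ec yz) (trans ed yz)) (λ c≢d ec ed → exA c≢d (trans ec yz) (trans ed yz)) b' a' b a

  fibre : (V → ℕ) → ℕ → List V
  fibre f i = filter (λ v → f v ℕ.≟ i) vs

  count : (V → ℕ) → ℕ → ℕ
  count f i = length (fibre f i)

  AtMostOne : (V → ℕ) → ℕ → Set
  AtMostOne f i = ∀ {a b} → f a ≡ i → f b ≡ i → a ≡ b

  ∈-fibre : ∀ f {i v} → f v ≡ i → v ∈ fibre f i
  ∈-fibre f {i} e = ∈-filter⁺ (λ v → f v ℕ.≟ i) (complete _) e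

  pair⇒2≤count : ∀ f {i a b} → a ≢ b → f a ≡ i → f b ≡ i → 2 ≤ count f i
  pair⇒2≤count f a≢b ea eb = unique-⊆-length ((a≢b ∷ []) ∷ [] ∷ [])
    λ { (here refl) → ∈-fibre f ea ; (there (here refl)) → ∈-fibre f eb }

  count≤1⇒atMostOne : ∀ f {i} → count f i ≤ 1 → AtMostOne f i
  count≤1⇒atMostOne f c {a} {b} ea eb with a ≟V b
  ... | yes e = e
  ... | no a≢b = ⊥-elim (<⇒≱ (pair⇒2≤count f a≢b ea eb) c)

  2≤count⇒pair : ∀ f {i} → 2 ≤ count f i → ∃ λ a → ∃ λ b → a ≢ b × f a ≡ i × f b ≡ i
  2≤count⇒pair f {i} c = go (fibre f i) c (Unique.filter⁺ P? unique) (λ v∈ → proj₂ (∈-filter⁻ P? {xs = vs} v∈))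
    where
    P? = λ v → f v ℕ.≟ i
    go : ∀ xs → 2 ≤ length xs → Unique xs → (∀ {v} → v ∈ xs → f v ≡ i) → ∃ λ a → ∃ λ b → a ≢ b × f a ≡ i × f b ≡ i
    go (_ ∷ []) (s≤s ()) _ _
    go (a ∷ b ∷ _) _ ((a≢b ∷ _) ∷ _) e = a , b , a≢b , e (here refl) , e (there (here refl))

  count0⇒hole : ∀ f {i} → count f i ≡ 0 → ∀ v → f v ≢ i
  count0⇒hole f {i} c v e with fibre f i | ∈-fibre f e
  count0⇒hole f () v e | _ ∷ _ | here _
  count0⇒hole f () v e | _ ∷ _ | there _

  GoodHole : (V → ℕ) → ℕ → Set
  GoodHole f h = count f h ≡ 0 × (count f (h ∸ 1) ≤ 1 ⊎ count f (suc h) ≤ 1)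

  goodHole? : ∀ f h → Dec (GoodHole f h)
  goodHole? f h = (count f h ℕ.≟ 0) ×-dec ((count f (h ∸ 1) ≤? 1) ⊎-dec (count f (suc h) ≤? 1))

  total : (V → ℕ) → ℕ → ℕ
  total f m = length (filter (λ v → f v <? m) vs)

  total-suc : ∀ f m → total f m + count f m ≤ total f (suc m)
  total-suc f m = subst (_≤ total f (suc m)) (length-++ (filter P? vs))
    (unique-⊆-length (Unique.++⁺ (Unique.filter⁺ P? unique) (Unique.filter⁺ Q? unique) disjoint)
      λ v∈ → [ below , at ]′ (∈-++⁻ (filter P? vs) v∈))
    where
    P? = λ v → f v <? m
    Q? = λ v → f v ℕ.≟ m
    disjoint : ∀ {v} → ¬ (v ∈ filter P? vs × v ∈ filter Q? vs)
    disjoint (p , q) = <⇒≢ (proj₂ (∈-filter⁻ P? {xs = vs} p)) (proj₂ (∈-filter⁻ Q? {xs = vs} q))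
    below : ∀ {v} → v ∈ filter P? vs → v ∈ filter (λ v → f v <? suc m) vs
    below p = ∈-filter⁺ (λ v → f v <? suc m) (complete _) (m<n⇒m<1+n (proj₂ (∈-filter⁻ P? {xs = vs} p)))
    at : ∀ {v} → v ∈ filter Q? vs → v ∈ filter (λ v → f v <? suc m) vs
    at q = ∈-filter⁺ (λ v → f v <? suc m) (complete _) (s≤s (≤-reflexive (proj₂ (∈-filter⁻ Q? {xs = vs} q))))

  total-≤ : ∀ f m → total f m ≤ length vs
  total-≤ f m = unique-⊆-length (Unique.filter⁺ P? unique) (λ {v} _ → complete v)
    where P? = λ v → f v <? m

  -- Scanning the labels below m: if no hole is good, then the vertices outnumber the labels as soon
  -- as a label is shared, except right after a hole, where the next label is shared.
  data Scan (f : V → ℕ) (m : ℕ) : Set where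
    quiet  : (∀ {i} → i < m → count f i ≤ 1) → m ≤ total f m → Scan f m
    loud   : suc m ≤ total f m → Scan f m
    onHole : m ≤ total f m → 2 ≤ count f m → Scan f m

  scan : ∀ f → (∀ {h} → h ≤ k → ¬ GoodHole f h) → ∀ m → m ≤ suc k → Scan f m
  scan f bad zero _ = quiet (λ ()) z≤n
  scan f bad (suc m) (s≤s m≤k) with scan f bad m (≤-trans m≤k (n≤1+n k))
  -- Two vertices on one label restore the surplus that the hole has used up.
  ... | onHole t c = loud (≤-trans (subst (_≤ total f m + count f m) (+-comm m 2) (+-mono-≤ t c)) (total-suc f m))
  ... | loud t = next (count f m) refl
    where
    next : ∀ c → count f m ≡ c → Scan f (suc m)
    -- The hole at `m` consumes the surplus but, not being good, is followed by a shared label.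
    next zero e = onHole (≤-trans t (m+n≤o⇒m≤o (total f m) (total-suc f m)))
      (≰⇒> λ c≤1 → bad m≤k (e , inj₂ c≤1))
    next (suc c) e = loud (≤-trans (subst (_≤ total f m + count f m) (+-comm (suc m) 1)
      (+-mono-≤ t (subst (1 ≤_) (≡-sym e) (s≤s z≤n)))) (total-suc f m))
  ... | quiet q t = next (count f m) refl
    where
    next : ∀ c → count f m ≡ c → Scan f (suc m)
    -- No label so far is shared, so a hole here would be good through its lower side.
    next zero e = ⊥-elim (bad m≤k (e , inj₁ (low m q e)))
      where
      low : ∀ m → (∀ {i} → i < m → count f i ≤ 1) → count f m ≡ 0 → count f (m ∸ 1) ≤ 1
      low zero _ e = subst (_≤ 1) (≡-sym e) z≤n
      low (suc m) q _ = q ≤-refl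
    next (suc zero) e = quiet below (≤-trans (subst (_≤ total f m + count f m) (+-comm m 1)
      (+-mono-≤ t (≤-reflexive (≡-sym e)))) (total-suc f m))
      where
      below : ∀ {i} → i < suc m → count f i ≤ 1
      below i<1+m with m<1+n⇒m<n∨m≡n i<1+m
      ... | inj₁ i<m = q i<m
      ... | inj₂ refl = ≤-reflexive e
    next (suc (suc c)) e = loud (≤-trans (subst (_≤ total f m + count f m) (+-comm m 2)
      (+-mono-≤ t (subst (2 ≤_) (≡-sym e) (s≤s (s≤s z≤n))))) (total-suc f m))

  -- Otherwise the scan over all labels ends in one of three impossible states: no label is shared,
  -- against `y` and `z`; there are more than `k + 1` vertices; or some vertex carries the label
  -- `k + 1`.
  goodHole : ∀ f → Bounded f → ∀ {y z} → y ≢ z → f y ≡ f z → ∃ λ h → h ≤ k × GoodHole f h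
  goodHole f bound {y} {z} y≢z yz with anyUpTo? (goodHole? f) (suc k)
  ... | yes (h , s≤s h≤k , g) = h , h≤k , g
  ... | no ¬g with scan f (λ h≤k g → ¬g (_ , s≤s h≤k , g)) (suc k) ≤-refl
  ...   | quiet q _ = ⊥-elim (<⇒≱ (pair⇒2≤count f y≢z yz refl) (q (s≤s (bound z))))
  ...   | loud t = ⊥-elim (<⇒≱ t (≤-trans (total-≤ f (suc k)) enough))
  ...   | onHole _ c with 2≤count⇒pair f c
  ...     | a , _ , _ , e , _ = ⊥-elim (<⇒≱ (subst (k <_) (≡-sym e) ≤-refl) (bound a))

  -- Two vertices blocked below would have the single vertex on `h - 1` as a common neighbour, which
  -- equal labels forbid.
  atMostOne⇒exclusiveBelow : ∀ {f} → Valid K f → ∀ {h i} → AtMostOne f (h ∸ 1) → Exclusive f i (BlockedBelow f h)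
  atMostOne⇒exclusiveBelow valid one a≢b ea eb (p , ap , refl) (q , bq , e) with one refl (cong (_∸ 1) e)
  ... | refl = distinct valid p a≢b ap bq (trans ea (≡-sym eb))

  atMostOne⇒exclusiveAbove : ∀ {f} → Valid K f → ∀ {h i} → AtMostOne f (suc h) → Exclusive f i (BlockedAbove f h)
  atMostOne⇒exclusiveAbove valid one a≢b ea eb (p , ap , e) (q , bq , e') with one e e'
  ... | refl = distinct valid p a≢b ap bq (trans ea (≡-sym eb))

  improvable : ∀ {f} → Valid K f → Bounded f → ∀ {y z} → y ≢ z → f y ≡ f z → Improvable f
  improvable {f} valid bound y≢z yz with goodHole f bound y≢z yz
  ... | h , h≤k , c0 , side with count f (h ∸ 1) ≤? 1 | count f (suc h) ≤? 1
  ...   | yes l | yes r = improve valid bound h≤k (count0⇒hole f c0) y≢z yz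
            (atMostOne⇒exclusiveBelow valid (count≤1⇒atMostOne f l)) (atMostOne⇒exclusiveAbove valid (count≤1⇒atMostOne f r))
  ...   | no l | no r = ⊥-elim ([ l , r ]′ side)
  -- The label `h + 1` is shared, so the pair to separate is chosen there: vertices with equal
  -- labels are never adjacent, hence none on that label is blocked above.
  ...   | yes l | no r with 2≤count⇒pair f (≰⇒> r)
  ...     | a , b , a≢b , ea , eb = improve valid bound h≤k (count0⇒hole f c0) a≢b (trans ea (≡-sym eb))
            (atMostOne⇒exclusiveBelow valid (count≤1⇒atMostOne f l))
            λ _ e _ (p , ap , e') _ → separated valid ap (inj₁ (trans e (trans eb (≡-sym e'))))
  improvable {f} valid bound y≢z yz | h , h≤k , c0 , side | no l | yes r with 2≤count⇒pair f (≰⇒> l)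
  ...     | a , b , a≢b , ea , eb = improve valid bound h≤k (count0⇒hole f c0) a≢b (trans ea (≡-sym eb))
            (λ _ e _ (p , ap , e') _ → separated valid ap (inj₁ (trans e (trans eb (≡-sym (cong (_∸ 1) e'))))))
            (atMostOne⇒exclusiveAbove valid (count≤1⇒atMostOne f r))

  Collides : (V → ℕ) → V → Set
  Collides f v = ∃ λ w → w ≢ v × f w ≡ f v

  collides? : ∀ f v → Dec (Collides f v)
  collides? f v = ∃? λ w → ¬? (w ≟V v) ×-dec (f w ℕ.≟ f v)

  collisions : (V → ℕ) → ℕ
  collisions f = length (filter (collides? f) vs)

  improves⇒fewer : ∀ {f g z} → Collides f z → Improves f z g → collisions g < collisions f
  improves⇒fewer {f} {g} {z} cz (_ , _ , coll) = unique-⊆-length {xs = z ∷ filter (collides? g) vs}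
    (All.tabulate (λ v∈ → fresh v∈) ∷ Unique.filter⁺ (collides? g) unique)
    λ { (here refl) → ∈-filter⁺ (collides? f) (complete _) cz
      ; (there v∈) → let (w , w≢v , e) = proj₂ (∈-filter⁻ (collides? g) {xs = vs} v∈) in
          ∈-filter⁺ (collides? f) (complete _) (w , w≢v , proj₁ (coll w≢v e)) }
    where
    fresh : ∀ {v} → v ∈ filter (collides? g) vs → z ≢ v
    fresh v∈ refl = let (w , w≢v , e) = proj₂ (∈-filter⁻ (collides? g) {xs = vs} v∈) in
      proj₂ (proj₂ (coll w≢v e)) refl

  Injective : (V → ℕ) → Set
  Injective f = ∀ {a b} → f a ≡ f b → a ≡ b

  injectivise : ∀ fuel f → Valid K f → Bounded f → collisions f < fuel → ∃ λ g → Valid K g × Bounded g × Injective g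
  injectivise (suc fuel) f valid bound (s≤s c) with ∃? (collides? f)
  ... | no none = f , valid , bound , inj
    where
    inj : Injective f
    inj {a} {b} e with a ≟V b
    ... | yes p = p
    ... | no p = ⊥-elim (none (b , a , p , e))
  ... | yes (z , y , y≢z , yz) with improvable valid bound y≢z yz
  ...   | w , cw , g , better = injectivise fuel g (proj₁ better) (proj₁ (proj₂ better))
            (≤-trans (improves⇒fewer cw better) c)

-- Star forests

module StarForest {n : ℕ} (F : Fin n → Fin n → Set) (F-sym : ∀ {x y} → F x y → F y x) (F-irrefl : ∀ {x} → ¬ F x x) where

  -- `c` sends every vertex to the centre of its star; centres and uncovered vertices are fixed.
  -- Idempotence says that no centre is a leaf of another star.
  record Forest (c : Fin n → Fin n) : Set where
    field
      edge : ∀ {v} → c v ≢ v → F (c v) v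
      idem : ∀ v → c (c v) ≡ c v
  open Forest

  Covered : (Fin n → Fin n) → Fin n → Set
  Covered c v = c v ≢ v ⊎ ∃ λ w → w ≢ v × c w ≡ v

  covered? : ∀ c v → Dec (Covered c v)
  covered? c v = ¬? (c v ≟ v) ⊎-dec Fin.any? (λ w → ¬? (w ≟ v) ×-dec (c w ≟ v))

  update : (Fin n → Fin n) → Fin n → Fin n → Fin n → Fin n
  update c v w x with x ≟ v
  ... | yes _ = w
  ... | no  _ = c x

  update-same : ∀ c v w → update c v w v ≡ w
  update-same c v w with v ≟ v
  ... | yes _ = refl
  ... | no p = ⊥-elim (p refl)

  update-other : ∀ c {v} w {x} → x ≢ v → update c v w x ≡ c x
  update-other c {v} w {x} x≢v with x ≟ v
  ... | yes p = ⊥-elim (x≢v p)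
  ... | no _ = refl

  Loose : (Fin n → Fin n) → Fin n → Set
  Loose c v = c v ≡ v × (∀ {u} → u ≢ v → c u ≢ v)

  Extends : (Fin n → Fin n) → Fin n → Set
  Extends c v = ∃ λ c' → Forest c' × Covered c' v × (∀ {u} → Covered c u → Covered c' u)

  leaf-not-center : ∀ {c} → Forest c → ∀ {w} → c w ≢ w → ∀ {u} → c u ≢ w
  leaf-not-center fo cw≢w {u} refl = cw≢w (idem fo u)

  -- Here `w` is a centre or still uncovered. As nothing points to `v`, turning `v` into a leaf of
  -- `w` breaks no star.
  attach : ∀ {c} → Forest c → ∀ {v w} → F w v → c w ≡ w → Loose c v →
    ∃ λ c' → Forest c' × Covered c' v × Covered c' w × (∀ {u} → Covered c u → Covered c' u)
  attach {c} fo {v} {w} wv cw (cv , lone) = c' , record { edge = edge' ; idem = idem' } , coverv , coverw , keep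
    where
    c' = update c v w
    w≢v : w ≢ v
    w≢v refl = F-irrefl wv
    edge' : ∀ {x} → c' x ≢ x → F (c' x) x
    edge' {x} p with x ≟ v
    ... | yes refl = wv
    ... | no _ = edge fo p
    idem' : ∀ x → c' (c' x) ≡ c' x
    idem' x with x ≟ v
    ... | yes refl = trans (update-other c w w≢v) cw
    ... | no x≢v = trans (update-other c w (lone x≢v)) (idem fo x)
    coverv : Covered c' v
    coverv = inj₁ λ e → w≢v (trans (≡-sym (update-same c v w)) e)
    coverw : Covered c' w
    coverw = inj₂ (v , w≢v ∘ ≡-sym , update-same c v w)
    keep : ∀ {u} → Covered c u → Covered c' u
    keep {u} = go (u ≟ v)
      where
      go : Dec (u ≡ v) → Covered c u → Covered c' u
      go (yes refl) _ = coverv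
      go (no u≢v) (inj₁ p) = inj₁ λ e → p (trans (≡-sym (update-other c w u≢v)) e)
      go (no u≢v) (inj₂ (x , x≢u , e)) =
        inj₂ (x , x≢u , trans (update-other c w λ { refl → u≢v (trans (≡-sym e) cv) }) e)

  -- `w` leaves its star and starts a new one with leaf `v`; the sibling leaf `y` keeps the old
  -- centre covered.
  detach : ∀ {c} → Forest c → ∀ {v w} → F w v → c w ≢ w → Loose c v → ∀ {y} → y ≢ c w → y ≢ w → c y ≡ c w → Extends c v
  detach {c} fo {v} {w} wv cw≢w (cv , lone) {y} y≢x y≢w cy with
    attach {c₁} (record { edge = edge₁ ; idem = idem₁ }) wv (update-same c w w) loose₁
    where
    c₁ = update c w w
    w≢v : w ≢ v
    w≢v refl = F-irrefl wv
    edge₁ : ∀ {x} → c₁ x ≢ x → F (c₁ x) x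
    edge₁ {x} p with x ≟ w
    ... | yes refl = ⊥-elim (p refl)
    ... | no _ = edge fo p
    idem₁ : ∀ x → c₁ (c₁ x) ≡ c₁ x
    idem₁ x with x ≟ w
    ... | yes refl = update-same c w w
    ... | no _ = trans (update-other c w (leaf-not-center fo cw≢w)) (idem fo x)
    loose₁ : Loose c₁ v
    loose₁ = trans (update-other c w (w≢v ∘ ≡-sym)) cv , lone₁
      where
      lone₁ : ∀ {u} → u ≢ v → c₁ u ≢ v
      lone₁ {u} u≢v with u ≟ w
      ... | yes refl = w≢v
      ... | no _ = lone u≢v
  ... | c' , fo' , coverv , coverw , keep = c' , fo' , coverv , keep'
    where
    c₁ = update c w w
    keep' : ∀ {u} → Covered c u → Covered c' u
    keep' {u} = go (u ≟ w)
      where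
      sibling : ∀ {x} → Dec (x ≡ w) → x ≢ u → c x ≡ u → Covered c₁ u
      sibling (yes refl) _ e = inj₂ (y , (λ q → y≢x (trans q (≡-sym e))) , trans (update-other c w y≢w) (trans cy e))
      sibling (no x≢w) x≢u e = inj₂ (_ , x≢u , trans (update-other c w x≢w) e)
      go : Dec (u ≡ w) → Covered c u → Covered c' u
      go (yes refl) _ = coverw
      go (no u≢w) (inj₁ p) = keep (inj₁ λ e → p (trans (≡-sym (update-other c w u≢w)) e))
      go (no u≢w) (inj₂ (x , x≢u , e)) = keep (sibling (x ≟ w) x≢u e)

  -- The star of `w` is the single edge to `c w`, so its two ends may exchange roles: `w` becomes
  -- the centre, and `v` is attached to it.
  reroot : ∀ {c} → Forest c → ∀ {v w} → F w v → c w ≢ w → Loose c v → (∀ {y} → y ≢ c w → c y ≡ c w → y ≡ w) → Extends c v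
  reroot {c} fo {v} {w} wv cw≢w (cv , lone) only with
    attach {c₁} (record { edge = edge₁ ; idem = idem₁ }) wv (update-same (update c (c w) w) w w) loose₁
    where
    x = c w
    c₁ = update (update c x w) w w
    w≢v : w ≢ v
    w≢v refl = F-irrefl wv
    x≢v : x ≢ v
    x≢v = lone w≢v
    edge₁ : ∀ {u} → c₁ u ≢ u → F (c₁ u) u
    edge₁ {u} p with u ≟ w
    ... | yes refl = ⊥-elim (p refl)
    ... | no _ with u ≟ x
    ...   | yes refl = F-sym (edge fo cw≢w)
    ...   | no _ = edge fo p
    idem₁ : ∀ u → c₁ (c₁ u) ≡ c₁ u
    idem₁ u with u ≟ w
    ... | yes refl = update-same _ w w
    ... | no u≢w with u ≟ x
    ...   | yes refl = update-same _ w w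
    ...   | no u≢x = trans (update-other _ w (leaf-not-center fo cw≢w))
              (trans (update-other c w λ e → u≢w (only u≢x e)) (idem fo u))
    loose₁ : Loose c₁ v
    loose₁ = trans (update-other _ w (w≢v ∘ ≡-sym)) (trans (update-other c w (x≢v ∘ ≡-sym)) cv) , lone₁
      where
      lone₁ : ∀ {u} → u ≢ v → c₁ u ≢ v
      lone₁ {u} u≢v with u ≟ w
      ... | yes refl = w≢v
      ... | no _ with u ≟ x
      ...   | yes refl = w≢v
      ...   | no _ = lone u≢v
  ... | c' , fo' , coverv , coverw , keep = c' , fo' , coverv , keep'
    where
    x = c w
    c₁ = update (update c x w) w w
    c₁-other : ∀ {u} → u ≢ w → u ≢ x → c₁ u ≡ c u
    c₁-other u≢w u≢x = trans (update-other _ w u≢w) (update-other c w u≢x)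
    c₁x : c₁ x ≡ w
    c₁x = trans (update-other _ w cw≢w) (update-same c x w)
    keep' : ∀ {u} → Covered c u → Covered c' u
    keep' {u} = go (u ≟ w) (u ≟ x)
      where
      go : Dec (u ≡ w) → Dec (u ≡ x) → Covered c u → Covered c' u
      go (yes refl) _ _ = coverw
      go (no _) (yes refl) _ = keep (inj₁ λ e → cw≢w (trans (≡-sym e) c₁x))
      go (no u≢w) (no u≢x) (inj₁ p) = keep (inj₁ λ e → p (trans (≡-sym (c₁-other u≢w u≢x)) e))
      go (no u≢w) (no u≢x) (inj₂ (p , p≢u , e)) = keep (inj₂ (p , p≢u , trans (c₁-other p≢w p≢x) e))
        where
        p≢w : p ≢ w
        p≢w refl = u≢x (≡-sym e)
        p≢x : p ≢ x
        p≢x refl = u≢x (trans (≡-sym e) (idem fo w))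

  extend : ∀ {c} → Forest c → ∀ {v w} → F w v → Extends c v
  extend {c} fo {v} {w} wv with covered? c v
  ... | yes cov = c , fo , cov , id
  ... | no ¬cov with c v ≟ v | c w ≟ w
  ...   | no p | _ = ⊥-elim (¬cov (inj₁ p))
  ...   | yes cv | yes cw = let (c' , fo' , a , _ , b) = attach fo wv cw (cv , λ u≢v e → ¬cov (inj₂ (_ , u≢v , e))) in c' , fo' , a , b
  ...   | yes cv | no cw≢w with Fin.any? (λ y → ¬? (y ≟ c w) ×-dec ¬? (y ≟ w) ×-dec (c y ≟ c w))
  ...     | yes (y , y≢x , y≢w , e) = detach fo wv cw≢w (cv , λ u≢v e → ¬cov (inj₂ (_ , u≢v , e))) y≢x y≢w e
  ...     | no none = reroot fo wv cw≢w (cv , λ u≢v e → ¬cov (inj₂ (_ , u≢v , e))) only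
    where
    only : ∀ {y} → y ≢ c w → c y ≡ c w → y ≡ w
    only {y} y≢x e with y ≟ w
    ... | yes p = p
    ... | no p = ⊥-elim (none (y , y≢x , p , e))

  -- Vertices can be treated one at a time because an extension never uncovers a vertex.
  spanning : (∀ v → Dec (∃ λ w → F w v)) → (xs : List (Fin n)) →
    ∃ λ c → Forest c × (∀ {v w} → v ∈ xs → F w v → Covered c v)
  spanning F? [] = id , record { edge = λ p → ⊥-elim (p refl) ; idem = λ _ → refl } , λ ()
  spanning F? (x ∷ xs) with spanning F? xs | F? x
  ... | c , fo , cov | no none = c , fo , λ { (here refl) wv → ⊥-elim (none (_ , wv)) ; (there v∈) wv → cov v∈ wv }
  ... | c , fo , cov | yes (w , wx) with extend fo wx
  ...   | c' , fo' , covx , keep = c' , fo' , λ { (here refl) _ → covx ; (there v∈) wv → keep (cov v∈ wv) }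

  -- From a star forest to a star matching.

  module _ {H : Graph (Fin n)} (F⇒H : ∀ {x y} → F x y → adj H x y ≡ true)
    (degree : ∀ {x} ls → Unique ls → (∀ {y} → y ∈ ls → F x y) → length ls ≤ 4) {c : Fin n → Fin n} (fo : Forest c) where

    isLeaf? : ∀ x w → Dec (w ≢ x × c w ≡ x)
    isLeaf? x w = ¬? (w ≟ x) ×-dec (c w ≟ x)

    leavesOf : Fin n → List (Fin n)
    leavesOf x = filter (isLeaf? x) (allFin n)

    leavesOf⁻ : ∀ {x w} → w ∈ leavesOf x → w ≢ x × c w ≡ x
    leavesOf⁻ {x} w∈ = proj₂ (∈-filter⁻ (isLeaf? x) {xs = allFin n} w∈)

    leavesOf⁺ : ∀ {x w} → w ≢ x → c w ≡ x → w ∈ leavesOf x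
    leavesOf⁺ {x} {w} p e = ∈-filter⁺ (isLeaf? x) (∈-allFin w) (p , e)

    leaf-edge : ∀ {x w} → w ∈ leavesOf x → F x w
    leaf-edge w∈ with leavesOf⁻ w∈
    ... | w≢x , refl = edge fo (w≢x ∘ ≡-sym)

    -- The clause placing `c v` in `xs` keeps the star of a further centre disjoint from the earlier
    -- ones; the last clause ensures that no covered vertex is lost.
    Stars : List (Fin n) → Set
    Stars xs = Σ (List (Star H)) λ ss → Unique (concatMap starVerts ss)
      × (∀ {v} → v ∈ concatMap starVerts ss → c v ∈ xs)
      × (∀ {v} → c v ∈ xs → Covered c v → v ∈ concatMap starVerts ss)

    stars : ∀ xs → Unique xs → Stars xs
    stars [] _ = [] , [] , (λ ()) , (λ ())
    stars (x ∷ xs) (x∉ ∷ u) with stars xs u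
    ... | ss , uss , sound , full = go (leavesOf x) refl
      where
      go : ∀ ls → leavesOf x ≡ ls → Stars (x ∷ xs)
      -- A vertex without leaves is itself a leaf or uncovered, and contributes no star.
      go [] eq = ss , uss , there ∘ sound , full'
        where
        no-leaf : ∀ {w} → w ≢ x → c w ≢ x
        no-leaf p e = case subst (_ ∈_) eq (leavesOf⁺ p e) of λ ()
        full' : ∀ {v} → c v ∈ x ∷ xs → Covered c v → v ∈ concatMap starVerts ss
        full' (there p) cov = full p cov
        full' {v} (here e) cov with v ≟ x
        ... | no v≢x = ⊥-elim (no-leaf v≢x e)
        full' {v} (here e) (inj₁ p) | yes refl = ⊥-elim (p e)
        full' {v} (here e) (inj₂ (w , w≢v , e')) | yes refl = ⊥-elim (no-leaf w≢v e')
      go ls@(l ∷ _) eq = star ∷ ss , Unique.++⁺ uniq uss disjoint , sound' , full'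
        where
        leaf : ∀ {w} → w ∈ ls → w ∈ leavesOf x
        leaf = subst (_ ∈_) (≡-sym eq)
        uls : Unique ls
        uls = subst Unique eq (Unique.filter⁺ (isLeaf? x) (Unique.allFin⁺ n))
        star : Star H
        star = record { center = x ; leaves = ls ; atLeast = s≤s z≤n ; atMost = degree ls uls (leaf-edge ∘ leaf)
          ; edges = All.tabulate (F⇒H ∘ leaf-edge ∘ leaf) }
        cx : c x ≡ x
        cx with leavesOf⁻ (leaf (here refl))
        ... | _ , refl = idem fo l
        to-x : ∀ {v} → v ∈ x ∷ ls → c v ≡ x
        to-x (here refl) = cx
        to-x (there v∈) = proj₂ (leavesOf⁻ (leaf v∈))
        uniq : Unique (x ∷ ls)
        uniq = All.tabulate (λ v∈ e → proj₁ (leavesOf⁻ (leaf v∈)) (≡-sym e)) ∷ uls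
        disjoint : ∀ {v} → ¬ (v ∈ x ∷ ls × v ∈ concatMap starVerts ss)
        disjoint (p , q) = All.lookup x∉ (sound q) (≡-sym (to-x p))
        sound' : ∀ {v} → v ∈ (x ∷ ls) ++ concatMap starVerts ss → c v ∈ x ∷ xs
        sound' p = [ here ∘ to-x , there ∘ sound ]′ (∈-++⁻ (x ∷ ls) p)
        full' : ∀ {v} → c v ∈ x ∷ xs → Covered c v → v ∈ (x ∷ ls) ++ concatMap starVerts ss
        full' (there p) cov = ∈-++⁺ʳ (x ∷ ls) (full p cov)
        full' {v} (here e) _ with v ≟ x
        ... | yes refl = here refl
        ... | no v≢x = there (∈-++⁺ˡ (subst (v ∈_) eq (leavesOf⁺ v≢x e)))

  starMatching : {H : Graph (Fin n)} → (∀ {x y} → F x y → adj H x y ≡ true) →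
    (∀ {x} ls → Unique ls → (∀ {y} → y ∈ ls → F x y) → length ls ≤ 4) → (∀ v → Dec (∃ λ w → F w v)) →
    Σ (FourStarMatching H) λ m → ∀ {v w} → F w v → v ∈ concatMap starVerts (proj₁ m)
  starMatching F⇒H degree F? with spanning F? (allFin n)
  ... | c , fo , cov with stars F⇒H degree fo (allFin n) (Unique.allFin⁺ n)
  ...   | ss , u , _ , full = (ss , u) , λ {v} wv → full (∈-allFin (c v)) (cov (∈-allFin v) wv)

-- From labelings to star matchings

_∈ℕ?_ : (i : ℕ) (is : List ℕ) → Dec (i ∈ is)
_∈ℕ?_ = DecMembership._∈?_ ℕ._≟_

original copy : {n : ℕ} → Fin n → MV n
original = inj₁
copy = inj₂ ∘ inj₁

root : {n : ℕ} → MV n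
root = inj₂ (inj₂ tt)

_≟MV_ : {n : ℕ} → DecidableEquality (MV n)
_≟MV_ = Sum.≡-dec _≟_ (Sum.≡-dec _≟_ Unit._≟_)

copy-injective : ∀ {n} {x y : Fin n} → copy x ≡ copy y → x ≡ y
copy-injective = inj₁-injective ∘ inj₂-injective

unrooted vertices : (n : ℕ) → List (MV n)
unrooted n = map original (allFin n) ++ map copy (allFin n)
vertices n = root ∷ unrooted n

original∈ : ∀ {n} (x : Fin n) → original x ∈ unrooted n
original∈ x = ∈-++⁺ˡ (∈-map⁺ original (∈-allFin x))

copy∈ : ∀ {n} (x : Fin n) → copy x ∈ unrooted n
copy∈ {n} x = ∈-++⁺ʳ (map original (allFin n)) (∈-map⁺ copy (∈-allFin x))

unrooted⁻ : ∀ {n} {v : MV n} → v ∈ unrooted n → ∃ λ x → v ≡ original x ⊎ v ≡ copy x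
unrooted⁻ {n} v∈ with ∈-++⁻ (map original (allFin n)) v∈
... | inj₁ p = let (x , _ , e) = ∈-map⁻ original p in x , inj₁ e
... | inj₂ p = let (x , _ , e) = ∈-map⁻ copy p in x , inj₂ e

vertices-complete : ∀ {n} (v : MV n) → v ∈ vertices n
vertices-complete (inj₁ x)         = there (original∈ x)
vertices-complete (inj₂ (inj₁ x))  = there (copy∈ x)
vertices-complete (inj₂ (inj₂ tt)) = here refl

unrooted-unique : ∀ n → Unique (unrooted n)
unrooted-unique n = Unique.++⁺ (Unique.map⁺ inj₁-injective (Unique.allFin⁺ n)) (Unique.map⁺ copy-injective (Unique.allFin⁺ n))
  λ (p , q) → case trans (≡-sym (proj₂ (proj₂ (∈-map⁻ original p)))) (proj₂ (proj₂ (∈-map⁻ copy q))) of λ ()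

vertices-unique : ∀ n → Unique (vertices n)
vertices-unique n = All.tabulate fresh ∷ unrooted-unique n
  where
  fresh : ∀ {v} → v ∈ unrooted n → root ≢ v
  fresh v∈ refl with unrooted⁻ v∈
  ... | _ , inj₁ ()
  ... | _ , inj₂ ()

length-unrooted : ∀ n → length (unrooted n) ≡ 2 * n
length-unrooted n = trans (length-++ (map original (allFin n)))
  (cong₂ _+_ (eq original) (trans (eq copy) (≡-sym (+-identityʳ n))))
  where
  eq : (h : Fin n → MV n) → length (map h (allFin n)) ≡ n
  eq h = trans (length-map h (allFin n)) (length-tabulate id)

compl-adj : ∀ {n} {G : Graph (Fin n)} {x y} → adj G x y ≡ false → x ≢ y → adj (compl G) x y ≡ true
compl-adj {x = x} {y} e x≢y rewrite e with x ≟ y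
... | yes p = ⊥-elim (x≢y p)
... | no _ = refl

compl-adj⁻ : ∀ {n} {G : Graph (Fin n)} {x y} → adj (compl G) x y ≡ true → adj G x y ≡ false
compl-adj⁻ {G = G} {x} {y} e with adj G x y
... | false = refl

near? : ∀ i j → Dec (Near i j)
near? i j = (i ℕ.≟ j) ⊎-dec (suc i ℕ.≟ j) ⊎-dec (i ℕ.≟ suc j)

module Consecutive {n : ℕ} (G : Graph (Fin n)) (r : ℕ) (g : MV n → ℕ) (valid : Valid (M G) g)
  (bound : ∀ v → g v ≤ 2 * n + r) (inj : ∀ {a b} → g a ≡ g b → a ≡ b) where

  k : ℕ
  k = 2 * n + r

  -- Pairs of copies are left out: copies are never adjacent in `M G`, so their being consecutive
  -- says nothing about `G`.
  data F (x y : Fin n) : Set where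
    consecutive : x ≢ y → Near (g (original x)) (g (original y)) ⊎ Near (g (original x)) (g (copy y))
      ⊎ Near (g (copy x)) (g (original y)) → F x y

  F? : ∀ x y → Dec (F x y)
  F? x y = map′ (λ (p , q) → consecutive p q) (λ { (consecutive p q) → p , q })
    (¬? (x ≟ y) ×-dec (near? _ _ ⊎-dec near? _ _ ⊎-dec near? _ _))

  F-sym : ∀ {x y} → F x y → F y x
  F-sym (consecutive x≢y (inj₁ nr)) = consecutive (x≢y ∘ ≡-sym) (inj₁ (near-sym nr))
  F-sym (consecutive x≢y (inj₂ (inj₁ nr))) = consecutive (x≢y ∘ ≡-sym) (inj₂ (inj₂ (near-sym nr)))
  F-sym (consecutive x≢y (inj₂ (inj₂ nr))) = consecutive (x≢y ∘ ≡-sym) (inj₂ (inj₁ (near-sym nr)))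

  F-irrefl : ∀ {x} → ¬ F x x
  F-irrefl (consecutive p _) = p refl

  near⇒nonadjacent : ∀ {a b} → Near (g a) (g b) → adj (M G) a b ≡ false
  near⇒nonadjacent {a} {b} nr with adj (M G) a b in e
  ... | false = refl
  ... | true = ⊥-elim (Valid.separated valid e nr)

  F⇒compl : ∀ {x y} → F x y → adj (compl G) x y ≡ true
  F⇒compl {x} {y} (consecutive x≢y nr) = compl-adj {G = G} (nonadj nr) x≢y
    where
    nonadj : Near (g (original x)) (g (original y)) ⊎ Near (g (original x)) (g (copy y)) ⊎ Near (g (copy x)) (g (original y)) →
      adj G x y ≡ false
    nonadj (inj₁ nr) = near⇒nonadjacent nr
    nonadj (inj₂ (inj₁ nr)) = near⇒nonadjacent nr
    nonadj (inj₂ (inj₂ nr)) = trans (sym G x y) (near⇒nonadjacent nr)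

  Labels : Fin n → ℕ → Set
  Labels y i = g (original y) ≡ i ⊎ g (copy y) ≡ i

  labels-injective : ∀ {y y' i} → Labels y i → Labels y' i → y ≡ y'
  labels-injective (inj₁ p) (inj₁ q) = inj₁-injective (inj (trans p (≡-sym q)))
  labels-injective (inj₂ p) (inj₂ q) = copy-injective (inj (trans p (≡-sym q)))
  labels-injective (inj₁ p) (inj₂ q) = case inj (trans p (≡-sym q)) of λ ()
  labels-injective (inj₂ p) (inj₁ q) = case inj (trans p (≡-sym q)) of λ ()

  -- At label 0 the lower side is 0 again, an extra entry that is harmless in an upper bound.
  sides : ℕ → List ℕ
  sides i = suc i ∷ i ∸ 1 ∷ []

  near-sides : ∀ {a b} → a ≢ b → Near (g a) (g b) → g b ∈ sides (g a)
  near-sides a≢b (inj₁ e) = ⊥-elim (a≢b (inj e))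
  near-sides a≢b (inj₂ (inj₁ e)) = here (≡-sym e)
  near-sides a≢b (inj₂ (inj₂ e)) = there (here (≡-sym (cong (_∸ 1) e)))

  degree : ∀ {x} ls → Unique ls → (∀ {y} → y ∈ ls → F x y) → length ls ≤ 4
  degree {x} ls u Fx = pigeonhole Labels labels-injective ls (sides (g (original x)) ++ sides (g (copy x))) u (nbr ∘ Fx)
    where
    nbr : ∀ {y} → F x y → Any (Labels y) (sides (g (original x)) ++ sides (g (copy x)))
    nbr (consecutive x≢y (inj₁ nr)) = Any.map inj₁ (∈-++⁺ˡ (near-sides (x≢y ∘ inj₁-injective) nr))
    nbr (consecutive x≢y (inj₂ (inj₁ nr))) = Any.map inj₂ (∈-++⁺ˡ (near-sides (λ ()) nr))
    nbr (consecutive x≢y (inj₂ (inj₂ nr))) = Any.map inj₁ (∈-++⁺ʳ (sides (g (original x))) (near-sides (λ ()) nr))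

  neighbour? : ∀ x → Dec (∃ λ w → F w x)
  neighbour? x = Fin.any? λ w → F? w x

  isolated : List (Fin n)
  isolated = filter (¬? ∘ neighbour?) (allFin n)

  -- The root is left out of `used`, so its label counts as free; hence the bound `r + 1` rather
  -- than `r` on the number of free labels.
  used free : List ℕ
  used = map g (unrooted n)
  free = filter (λ i → ¬? (i ∈ℕ? used)) (upTo (suc k))

  length-free : length free ≤ suc r
  length-free = +-cancelˡ-≤ (2 * n) _ _ (begin
    2 * n + length free         ≡⟨ cong (_+ length free) (≡-sym (trans (length-map g (unrooted n)) (length-unrooted n))) ⟩
    length used + length free   ≡⟨ ≡-sym (length-++ used) ⟩
    length (used ++ free)       ≤⟨ unique-⊆-length (Unique.++⁺ (Unique.map⁺ inj (unrooted-unique n)) (Unique.filter⁺ P? (Unique.upTo⁺ (suc k))) disjoint)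
                                     (λ p → [ inrange , proj₁ ∘ ∈-filter⁻ P? {xs = upTo (suc k)} ]′ (∈-++⁻ used p)) ⟩
    length (upTo (suc k))       ≡⟨ length-upTo (suc k) ⟩
    suc k                       ≡⟨ ≡-sym (+-suc (2 * n) r) ⟩
    2 * n + suc r               ∎)
    where
    open ≤-Reasoning
    P? = λ i → ¬? (i ∈ℕ? used)
    disjoint : ∀ {i} → ¬ (i ∈ used × i ∈ free)
    disjoint (p , q) = proj₂ (∈-filter⁻ P? {xs = upTo (suc k)} q) p
    inrange : ∀ {i} → i ∈ used → i ∈ upTo (suc k)
    inrange p with ∈-map⁻ g p
    ... | v , _ , refl = ∈-upTo⁺ (s≤s (bound v))

  isolated-side : ∀ {x} → ¬ (∃ λ w → F w x) → ∀ {i} → i ≤ k → i ≢ g (original x) → Near i (g (original x)) →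
    i ∈ free ⊎ g (copy x) ≡ i
  isolated-side {x} iso {i} i≤k i≢ nr with i ∈ℕ? used
  ... | no i∉ = inj₁ (∈-filter⁺ (λ i → ¬? (i ∈ℕ? used)) (∈-upTo⁺ (s≤s i≤k)) i∉)
  ... | yes i∈ with ∈-map⁻ g i∈
  ...   | v , v∈ , refl with unrooted⁻ v∈
  ...     | y , e with y ≟ x
  ...       | no y≢x = ⊥-elim (iso (y , consecutive y≢x (near e)))
    where
    near : v ≡ original y ⊎ v ≡ copy y → Near (g (original y)) (g (original x)) ⊎ Near (g (original y)) (g (copy x)) ⊎ Near (g (copy y)) (g (original x))
    near (inj₁ refl) = inj₁ nr
    near (inj₂ refl) = inj₂ (inj₂ nr)
  isolated-side iso i≤k i≢ nr | yes i∈ | v , v∈ , refl | y , inj₁ refl | yes refl = ⊥-elim (i≢ refl)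
  isolated-side iso i≤k i≢ nr | yes i∈ | v , v∈ , refl | y , inj₂ refl | yes refl = inj₂ refl

  -- The labels having an end of the range or a free label beside them: the first half looks below,
  -- the second above.
  slots : List ℕ
  slots = (0 ∷ map suc free) ++ (k ∷ map (_∸ 1) free)

  -- An occupied side of the label of `original x` can only carry `copy x`, which cannot stand on
  -- both sides at once.
  isolated-slot : ∀ {x} → ¬ (∃ λ w → F w x) → g (original x) ∈ slots
  isolated-slot {x} iso with g (original x) in e
  ... | zero = here refl
  ... | suc j with isolated-side iso {j} (≤-trans (n≤1+n j) j<k) (λ q → 1+n≢n (trans (≡-sym e) (≡-sym q))) (inj₂ (inj₁ (≡-sym e)))
    where
    j<k : suc j ≤ k
    j<k = subst (_≤ k) e (bound (original x))
  ...   | inj₁ j∈ = there (∈-++⁺ˡ (∈-map⁺ suc j∈))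
  ...   | inj₂ copy-j with suc j ℕ.≟ k
  ...     | yes j≡k = ∈-++⁺ʳ (0 ∷ map suc free) (here j≡k)
  ...     | no j≢k with isolated-side iso {suc (suc j)} (≤∧≢⇒< (subst (_≤ k) e (bound (original x))) j≢k)
                (λ q → 1+n≢n (trans q e)) (inj₂ (inj₂ (cong suc (≡-sym e))))
  ...       | inj₁ j∈ = ∈-++⁺ʳ (0 ∷ map suc free) (there (∈-map⁺ (_∸ 1) j∈))
  ...       | inj₂ copy-j' = ⊥-elim (<⇒≢ (≤-trans (n≤1+n _) ≤-refl) (trans (≡-sym copy-j) copy-j'))

  length-isolated : length isolated ≤ 2 * r + 4
  length-isolated = begin
    length isolated             ≤⟨ pigeonhole (λ x i → g (original x) ≡ i) (λ p q → inj₁-injective (inj (trans p (≡-sym q)))) isolated slots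
                                     (Unique.filter⁺ P? (Unique.allFin⁺ n)) (λ x∈ → isolated-slot (proj₂ (∈-filter⁻ P? {xs = allFin n} x∈))) ⟩
    length slots                ≡⟨ length-++ (0 ∷ map suc free) ⟩
    suc (length (map suc free)) + suc (length (map (_∸ 1) free))  ≡⟨ cong₂ (λ a b → suc a + suc b) (length-map suc free) (length-map (_∸ 1) free) ⟩
    suc (length free) + suc (length free) ≤⟨ +-mono-≤ (s≤s length-free) (s≤s length-free) ⟩
    suc (suc r) + suc (suc r)   ≡⟨ solve 1 (λ r → (con 2 :+ r) :+ (con 2 :+ r) := con 2 :* r :+ con 4) refl r ⟩
    2 * r + 4                   ∎
    where
    open ≤-Reasoning
    open +-*-Solver
    P? = ¬? ∘ neighbour?

  matching : Σ (FourStarMatching (compl G)) λ m → n ≤ order m + (2 * r + 4)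
  matching with StarForest.starMatching F F-sym F-irrefl F⇒compl degree neighbour?
  ... | m , covers = m , (begin
    n                           ≡⟨ ≡-sym (length-tabulate id) ⟩
    length (allFin n)           ≤⟨ unique-⊆-length (Unique.allFin⁺ n) (λ {x} _ → covered x) ⟩
    length (covering ++ isolated) ≡⟨ length-++ covering ⟩
    order m + length isolated   ≤⟨ +-monoʳ-≤ (order m) length-isolated ⟩
    order m + (2 * r + 4)       ∎)
    where
    open ≤-Reasoning
    covering : List (Fin n)
    covering = concatMap starVerts (proj₁ m)
    covered : ∀ x → x ∈ covering ++ isolated
    covered x with neighbour? x
    ... | yes (w , wx) = ∈-++⁺ˡ (covers wx)
    ... | no iso = ∈-++⁺ʳ covering (∈-filter⁺ (¬? ∘ neighbour?) (∈-allFin x) iso)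

span⇒matching : ∀ {n} (G : Graph (Fin n)) r → HasSpan (M G) (2 * n + r) →
  Σ (FourStarMatching (compl G)) λ m → n ≤ order m + (2 * r + 4)
span⇒matching {n} G r (f , l21 , bound) with
  Injectivise.injectivise _≟MV_ (M G) (vertices n) vertices-complete (vertices-unique n) (2 * n + r)
    -- `M G` has `2n + 1` vertices and there are `2n + r + 1` labels, so the labels suffice even for
    -- `r = 0`.
    (s≤s (subst (_≤ 2 * n + r) (≡-sym (length-unrooted n)) (m≤m+n (2 * n) r)))
    _ f (L21⇒valid l21) bound ≤-refl
... | g , valid , bound' , inj = Consecutive.matching G r g valid bound' inj

-- From star matchings to labelings

module Sequence {V : Set} (_≟V_ : DecidableEquality V) (K : Graph V) where

  Compatible : Maybe V → Maybe V → Set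
  Compatible (just a) (just b) = adj K a b ≡ false
  Compatible _        _        = ⊤

  infixr 5 _∷_
  data Path : Maybe V → List (Maybe V) → Maybe V → Set where
    [_] : ∀ a → Path a (a ∷ []) a
    _∷_ : ∀ {a b c s} → Compatible a b → Path b s c → Path a (a ∷ s) c

  path-head : ∀ {a b s} → Path a s b → a ∈ s
  path-head [ _ ]   = here refl
  path-head (_ ∷ _) = here refl

  append : ∀ {a b c d s t} → Path a s b → Compatible b c → Path c t d → Path a (s ++ t) d
  append [ a ]   e q = e ∷ q
  append (x ∷ p) e q = x ∷ append p e q

  position : List (Maybe V) → V → ℕ
  position []             v = 0
  position (nothing ∷ s)  v = suc (position s v)
  position (just a ∷ s)   v with a ≟V v
  ... | yes _ = 0
  ... | no  _ = suc (position s v)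

  position-bound : ∀ {s v} → just v ∈ s → position s v < length s
  position-bound {just a ∷ s} {v} p with a ≟V v
  ... | yes _ = s≤s z≤n
  position-bound (here refl) | no a≢v = ⊥-elim (a≢v refl)
  position-bound (there p)   | no _   = s≤s (position-bound p)
  position-bound {nothing ∷ s} (there p) = s≤s (position-bound p)

  position-injective : ∀ {s v w} → just v ∈ s → just w ∈ s → position s v ≡ position s w → v ≡ w
  position-injective {nothing ∷ s} (there p) (there q) e = position-injective p q (suc-injective e)
  position-injective {just a ∷ s} {v} {w} p q e with a ≟V v | a ≟V w
  ... | yes refl | yes refl = refl
  position-injective (here refl) q e | no a≢v | no _ = ⊥-elim (a≢v refl)
  position-injective (there p) (here refl) e | no _ | no a≢w = ⊥-elim (a≢w refl)
  position-injective (there p) (there q) e | no _ | no _ = position-injective p q (suc-injective e)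

  position-head : ∀ {a b s v} → Path a s b → position s v ≡ 0 → a ≡ just v
  position-head [ nothing ] ()
  position-head (_∷_ {nothing} _ _) ()
  position-head {v = v} [ just a ] e with a ≟V v
  ... | yes refl = refl
  position-head {v = v} (_∷_ {just a} _ _) e with a ≟V v
  ... | yes refl = refl

  position-consecutive : ∀ {a b s v w} → Path a s b → just v ∈ s → just w ∈ s →
    suc (position s v) ≡ position s w → adj K v w ≡ false
  position-consecutive (_∷_ {nothing} x p) (there v∈) (there w∈) e = position-consecutive p v∈ w∈ (suc-injective e)
  position-consecutive {v = v} {w} [ just a ] (here refl) (here refl) e = ⊥-elim (1+n≢n e)
  position-consecutive {v = v} {w} (_∷_ {just a} x p) v∈ w∈ e with a ≟V v | a ≟V w
  position-consecutive (x ∷ p) v∈ (here refl) e | _ | no a≢w = ⊥-elim (a≢w refl)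
  position-consecutive (x ∷ p) v∈ (there w∈) e | yes refl | no _ with position-head p (suc-injective (≡-sym e))
  ... | refl = x
  position-consecutive (x ∷ p) (here refl) (there w∈) e | no a≢v | no _ = ⊥-elim (a≢v refl)
  position-consecutive (x ∷ p) (there v∈) (there w∈) e | no _ | no _ = position-consecutive p v∈ w∈ (suc-injective e)

  -- Labels are positions. They are pairwise distinct, which settles distance two; consecutive ones
  -- hold nonadjacent vertices, which settles distance one.
  path⇒span : ∀ {a b s k} → Path a s b → length s ≤ suc k → (∀ v → just v ∈ s) → HasSpan K k
  path⇒span {s = s} path len all = f , (d1 , d2) , λ v → ≤-pred (≤-trans (position-bound (all v)) len)
    where
    f : V → ℕ
    f = position s
    d1 : ∀ x y → Dist1 K x y → 2 ≤ ∣ f x - f y ∣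
    d1 x y xy = ¬near⇒far _ _ far
      where
      far : ¬ Near (f x) (f y)
      far (inj₁ e) with position-injective (all x) (all y) e
      ... | refl = case trans (≡-sym xy) (irrefl K x) of λ ()
      far (inj₂ (inj₁ e)) = case trans (≡-sym xy) (position-consecutive path (all x) (all y) e) of λ ()
      far (inj₂ (inj₂ e)) =
        case trans (≡-sym xy) (trans (sym K x y) (position-consecutive path (all y) (all x) (≡-sym e))) of λ ()
    d2 : ∀ x y → Dist2 K x y → f x ≢ f y
    d2 x y (x≢y , _) e = x≢y (position-injective (all x) (all y) e)

-- Laying out stars and unmatched vertices.

module Construction {n : ℕ} (G : Graph (Fin n)) where
  open Sequence _≟MV_ (M G)

  Slot : Set
  Slot = Maybe (MV n)

  o c : Fin n → Slot
  o = just ∘ original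
  c = just ∘ copy

  Holds : List Slot → Fin n → Set
  Holds s v = o v ∈ s × c v ∈ s

  -- The slot sequence is c first ∷ rest; the leading copy is kept apart for rotate.
  record Block (vs : List (Fin n)) : Set where
    field
      {first last} : Fin n
      {rest}       : List Slot
      path         : Path (o first) rest (c last)
      size         : suc (length rest) ≡ 2 * length vs
      holds        : All (Holds (c first ∷ rest)) vs

  -- It opens with an original, so that the root may stand directly before it, and closes with a
  -- copy, so that a block may follow.
  record Lead (vs : List (Fin n)) : Set where
    field
      {first last} : Fin n
      {slots}      : List Slot
      path         : Path (o first) slots (c last)
      size         : length slots ≡ 2 * length vs
      holds        : All (Holds slots) vs

  private
    at0 : {A : Set} {x : A} {xs : List A} → x ∈ x ∷ xs
    at0 = here refl
    at1 : {A : Set} {x a : A} {xs : List A} → x ∈ a ∷ x ∷ xs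
    at1 = there at0
    at2 : {A : Set} {x a b : A} {xs : List A} → x ∈ a ∷ b ∷ x ∷ xs
    at2 = there at1
    at3 : {A : Set} {x a b c : A} {xs : List A} → x ∈ a ∷ b ∷ c ∷ x ∷ xs
    at3 = there at2
    at4 : {A : Set} {x a b c d : A} {xs : List A} → x ∈ a ∷ b ∷ c ∷ d ∷ x ∷ xs
    at4 = there at3
    at5 : {A : Set} {x a b c d e : A} {xs : List A} → x ∈ a ∷ b ∷ c ∷ d ∷ e ∷ x ∷ xs
    at5 = there at4

  opp : ∀ {x l} → adj (compl G) x l ≡ true → adj G l x ≡ false
  opp {x} {l} e = trans (sym G l x) (compl-adj⁻ {G = G} e)

  -- The centre and its copy each touch at most two leaves, along complement edges. Every other
  -- consecutive pair consists of a vertex and its own copy or of two copies, and these are never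
  -- adjacent.
  starBlock : (s : Star (compl G)) → Block (starVerts s)
  starBlock record { center = x ; leaves = [] ; atLeast = () }
  starBlock record { center = x ; leaves = l₁ ∷ [] ; edges = e₁ ∷ [] } = record
    { path = opp e₁ ∷ irrefl G x ∷ [ c x ]
    ; size = refl
    ; holds = (at2 , at3) ∷ (at1 , at0) ∷ [] }
  starBlock record { center = x ; leaves = l₁ ∷ l₂ ∷ [] ; edges = e₁ ∷ e₂ ∷ [] } = record
    { path = opp e₁ ∷ irrefl G x ∷ opp e₂ ∷ irrefl G l₂ ∷ [ c l₂ ]
    ; size = refl
    ; holds = (at2 , at3) ∷ (at1 , at0) ∷ (at4 , at5) ∷ [] }
  starBlock record { center = x ; leaves = l₁ ∷ l₂ ∷ l₃ ∷ [] ; edges = e₁ ∷ e₂ ∷ e₃ ∷ [] } = record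
    { path = opp e₁ ∷ compl-adj⁻ {G = G} e₂ ∷ irrefl G l₂ ∷ refl ∷ opp e₃ ∷ irrefl G l₃ ∷ [ c l₃ ]
    ; size = refl
    ; holds = (at2 , at5) ∷ (at1 , at0) ∷ (at3 , at4) ∷ (there at5 , there (there at5)) ∷ [] }
  starBlock record { center = x ; leaves = l₁ ∷ l₂ ∷ l₃ ∷ l₄ ∷ [] ; edges = e₁ ∷ e₂ ∷ e₃ ∷ e₄ ∷ [] } = record
    { path = opp e₁ ∷ compl-adj⁻ {G = G} e₂ ∷ irrefl G l₂ ∷ refl ∷ irrefl G l₃ ∷ opp e₃ ∷ opp e₄ ∷ irrefl G l₄ ∷ [ c l₄ ]
    ; size = refl
    ; holds = (at2 , there (there at5)) ∷ (at1 , at0) ∷ (at3 , at4) ∷ (there at5 , at5)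
        ∷ (there (there (there at5)) , there (there (there (there at5)))) ∷ [] }
  starBlock record { leaves = _ ∷ _ ∷ _ ∷ _ ∷ _ ∷ _ ; atMost = s≤s (s≤s (s≤s (s≤s ()))) }

  holds-++ˡ : ∀ {s t vs} → All (Holds s) vs → All (Holds (s ++ t)) vs
  holds-++ˡ = All.map λ (p , q) → ∈-++⁺ˡ p , ∈-++⁺ˡ q

  holds-++ʳ : ∀ s {t vs} → All (Holds t) vs → All (Holds (s ++ t)) vs
  holds-++ʳ s = All.map λ (p , q) → ∈-++⁺ʳ s p , ∈-++⁺ʳ s q

  size-++ : ∀ {A B : Set} (s t : List A) (us vs : List B) → length s ≡ 2 * length us → length t ≡ 2 * length vs →
    length (s ++ t) ≡ 2 * length (us ++ vs)
  size-++ s t us vs p q = trans (length-++ s) (trans (cong₂ _+_ p q)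
    (trans (≡-sym (*-distribˡ-+ 2 (length us) (length vs))) (cong (2 *_) (≡-sym (length-++ us)))))

  leadBlock : ∀ {us vs} → Lead us → Block vs → Lead (us ++ vs)
  leadBlock {us} {vs} l b = record
    { path = append L.path refl (irrefl G B.first ∷ B.path)
    ; size = size-++ L.slots (c B.first ∷ B.rest) us vs L.size B.size
    ; holds = All.++⁺ (holds-++ˡ L.holds) (holds-++ʳ L.slots B.holds) }
    where
    module L = Lead l
    module B = Block b

  blockBlock : ∀ {us vs} → Block us → Block vs → Block (us ++ vs)
  blockBlock {us} {vs} a b = record
    { path = append A.path refl (irrefl G B.first ∷ B.path)
    ; size = size-++ (c A.first ∷ A.rest) (c B.first ∷ B.rest) us vs A.size B.size
    ; holds = All.++⁺ (holds-++ˡ A.holds) (holds-++ʳ (c A.first ∷ A.rest) B.holds) }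
    where
    module A = Block a
    module B = Block b

  single : ∀ w → Lead (w ∷ [])
  single w = record { path = irrefl G w ∷ [ c w ] ; size = refl ; holds = (at0 , at1) ∷ [] }

  starsBlock : ∀ s ss → Block (concatMap starVerts (s ∷ ss))
  starsBlock s [] = subst Block (≡-sym (++-identityʳ (starVerts s))) (starBlock s)
  starsBlock s (s' ∷ ss) = blockBlock (starBlock s) (starsBlock s' ss)

  singleStars : ∀ w ss → Lead (w ∷ concatMap starVerts ss)
  singleStars w [] = single w
  singleStars w (s ∷ ss) = leadBlock (single w) (starsBlock s ss)

  -- Moving the leading copy to the end frees the slot in front of an original vertex.
  rotate : ∀ {vs} → Block vs → Lead vs
  rotate {vs} b = record
    { path = append B.path refl [ c B.first ]
    ; size = trans (length-++ B.rest) (trans (+-comm (length B.rest) 1) B.size)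
    ; holds = All.map (λ (p , q) → turn p , turn q) B.holds }
    where
    module B = Block b
    turn : ∀ {a} → a ∈ c B.first ∷ B.rest → a ∈ B.rest ++ c B.first ∷ []
    turn (here e)  = ∈-++⁺ʳ B.rest (here e)
    turn (there p) = ∈-++⁺ˡ p

  record Tail (r : ℕ) (sep : Slot) (ws : List (Fin n)) : Set where
    field
      {last}  : Slot
      {slots} : List Slot
      path    : Path sep slots last
      size    : length slots ≤ 2 * length ws + suc r
      holds   : All (Holds slots) ws

  -- Each separator is followed by at most two vertices, as `w w' x' x`, and a blank then parts `x`
  -- from the next original. So `2r + 2` vertices need at most `r + 1` separators counting the given
  -- one, which is the last term of `size`.
  tail : ∀ r {sep} → (∀ {x} → Compatible sep (o x)) → ∀ ws → length ws ≤ 2 * r + 2 → Tail r sep ws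
  tail r {sep} ok [] _ = record { path = [ sep ] ; size = s≤s z≤n ; holds = [] }
  tail r ok (w ∷ []) _ = record { path = ok ∷ irrefl G w ∷ [ c w ] ; size = s≤s (s≤s (s≤s z≤n)) ; holds = (at1 , at2) ∷ [] }
  tail r ok (w ∷ x ∷ []) _ = record
    { path = ok ∷ irrefl G w ∷ refl ∷ irrefl G x ∷ [ o x ]
    ; size = s≤s (s≤s (s≤s (s≤s (s≤s z≤n))))
    ; holds = (at1 , at2) ∷ (at4 , at3) ∷ [] }
  tail zero ok (w ∷ x ∷ y ∷ ws) (s≤s (s≤s ()))
  tail (suc r) {sep} ok (w ∷ x ∷ y ∷ ws) (s≤s le) = record
    { path = ok ∷ irrefl G w ∷ refl ∷ irrefl G x ∷ tt ∷ T.path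
    ; size = begin
        5 + length T.slots                 ≤⟨ +-monoʳ-≤ 5 T.size ⟩
        5 + (2 * suc (length ws) + suc r)  ≡⟨ solve 2 (λ l r → con 5 :+ (con 2 :* (con 1 :+ l) :+ (con 1 :+ r)) := con 2 :* (con 3 :+ l) :+ (con 2 :+ r)) refl (length ws) r ⟩
        2 * (3 + length ws) + suc (suc r)  ∎
    ; holds = (at1 , at2) ∷ (at4 , at3) ∷ holds-++ʳ (sep ∷ o w ∷ c w ∷ c x ∷ o x ∷ []) T.holds }
    where
    open ≤-Reasoning
    open +-*-Solver
    le' : suc (length ws) ≤ 2 * r + 2
    le' = ≤-pred (subst (suc (suc (length ws)) ≤_) (solve 1 (λ r → r :+ (con 1 :+ (r :+ con 0)) :+ con 2 := con 1 :+ (con 2 :* r :+ con 2)) refl r) le)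
    module T = Tail (tail r {nothing} tt (y ∷ ws) le')

  finish : ∀ {a b s} k → Path a s b → length s ≤ suc k → just root ∈ s → (∀ v → Holds s v) → HasSpan (M G) k
  finish k path len r∈ all = path⇒span path len λ
    { (inj₁ x) → proj₁ (all x) ; (inj₂ (inj₁ x)) → proj₂ (all x) ; (inj₂ (inj₂ tt)) → r∈ }

  leadSpan : ∀ r {vs} → Lead vs → length vs ≤ n → (∀ v → v ∈ vs) → HasSpan (M G) (2 * n + r)
  leadSpan r {vs} l len all = finish (2 * n + r) (refl ∷ L.path)
    (s≤s (≤-trans (≤-reflexive L.size) (≤-trans (*-monoʳ-≤ 2 len) (m≤m+n (2 * n) r)))) at0
    (λ v → let (p , q) = All.lookup L.holds (all v) in there p , there q)
    where module L = Lead l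

  -- The root serves as the first separator of the tail. Placing `w' w` before it lets it stand
  -- between two originals, to which it is nonadjacent.
  leadTailSpan : ∀ r {vs} → Lead vs → ∀ w ws → length ws ≤ 2 * r + 2 → length vs + suc (length ws) ≤ n →
    (∀ v → v ∈ vs ++ w ∷ ws) → HasSpan (M G) (2 * n + r)
  leadTailSpan r {vs} l w ws short len all = finish (2 * n + r)
    (append L.path refl (irrefl G w ∷ refl ∷ T.path)) size
    (∈-++⁺ʳ L.slots (there (there (path-head T.path))))
    (λ v → All.lookup (All.++⁺ {xs = vs} (holds-++ˡ L.holds)
       (holds-++ʳ L.slots ((at1 , at0) ∷ holds-++ʳ (c w ∷ o w ∷ []) T.holds))) (all v))
    where
    module L = Lead l
    module T = Tail (tail r {just root} refl ws short)
    open ≤-Reasoning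
    open +-*-Solver
    size : length (L.slots ++ c w ∷ o w ∷ T.slots) ≤ suc (2 * n + r)
    size = begin
      length (L.slots ++ c w ∷ o w ∷ T.slots)               ≡⟨ length-++ L.slots ⟩
      length L.slots + (2 + length T.slots)                 ≤⟨ +-mono-≤ (≤-reflexive L.size) (+-monoʳ-≤ 2 T.size) ⟩
      2 * length vs + (2 + (2 * length ws + suc r))         ≡⟨ solve 3 (λ a b r → con 2 :* a :+ (con 2 :+ (con 2 :* b :+ (con 1 :+ r))) := con 1 :+ (con 2 :* (a :+ (con 1 :+ b)) :+ r)) refl (length vs) (length ws) r ⟩
      suc (2 * (length vs + suc (length ws)) + r)           ≤⟨ s≤s (+-monoˡ-≤ r (*-monoʳ-≤ 2 len)) ⟩
      suc (2 * n + r)                                       ∎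

  partitionSpan : ∀ r ss ws → length ws ≤ 2 * r + 4 → length ws + length (concatMap starVerts ss) ≤ n →
    (∀ v → v ∈ ws ++ concatMap starVerts ss) → HasSpan (M G) (2 * n + r)
  partitionSpan r [] [] _ _ all = finish (2 * n + r) [ just root ] (s≤s z≤n) at0 (λ v → case all v of λ ())
  -- No unmatched vertex is available to open the sequence, so rotation supplies the original that
  -- has to follow the root.
  partitionSpan r (s ∷ ss) [] _ len all = leadSpan r (rotate (starsBlock s ss)) len all
  partitionSpan r ss (w ∷ []) _ len all = leadSpan r (singleStars w ss) len all
  -- Two unmatched vertices stand at the ends of the stars, `w` in front and `x` behind, which
  -- leaves at most `2r + 2` for the tail.
  partitionSpan r ss (w ∷ x ∷ ws) short len all =
    leadTailSpan r (singleStars w ss) x ws (+-cancelˡ-≤ 2 _ _ (subst (2 + length ws ≤_) (eq r) short))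
      (subst (_≤ n) (solve 2 (λ a b → (con 2 :+ a) :+ b := (con 1 :+ b) :+ (con 1 :+ a)) refl (length ws) (length (concatMap starVerts ss))) len)
      (λ v → reorder (all v))
    where
    open +-*-Solver
    eq : ∀ r → 2 * r + 4 ≡ 2 + (2 * r + 2)
    eq = solve 1 (λ r → con 2 :* r :+ con 4 := con 2 :+ (con 2 :* r :+ con 2)) refl
    covering = concatMap starVerts ss
    reorder : ∀ {v} → v ∈ (w ∷ x ∷ ws) ++ covering → v ∈ (w ∷ covering) ++ x ∷ ws
    reorder (here e) = here e
    reorder (there p) = there ([ ∈-++⁺ʳ covering , ∈-++⁺ˡ ]′ (∈-++⁻ (x ∷ ws) p))

  matching⇒span : ∀ r (m : FourStarMatching (compl G)) → n ≤ order m + (2 * r + 4) → HasSpan (M G) (2 * n + r)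
  matching⇒span r m@(ss , uss) le = partitionSpan r ss missed
    (+-cancelˡ-≤ (order m) _ _ (≤-trans (≤-trans (≤-reflexive (+-comm (order m) _)) total) le)) total cover
    where
    _∈?_ = DecMembership._∈?_ (_≟_ {n})
    covering = concatMap starVerts ss
    P? = λ v → ¬? (v ∈? covering)
    missed = filter P? (allFin n)
    total : length missed + length covering ≤ n
    total = ≤-trans (≤-reflexive (≡-sym (length-++ missed)))
      (≤-trans (unique-⊆-length (Unique.++⁺ (Unique.filter⁺ P? (Unique.allFin⁺ n)) uss
          (λ (p , q) → proj₂ (∈-filter⁻ P? {xs = allFin n} p) q)) (λ {v} _ → ∈-allFin v))
        (≤-reflexive (length-tabulate id)))
    cover : ∀ v → v ∈ missed ++ covering
    cover v with v ∈? covering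
    ... | yes v∈ = ∈-++⁺ʳ missed v∈
    ... | no v∉ = ∈-++⁺ˡ (∈-filter⁺ P? (∈-allFin v) v∉)

-- Decidability and the extremal values

-- Quantifying over all decidable `P` makes searches compose: a list is searched entry by entry.
SearchOn : {A : Set} → (A → Set) → Set₁
SearchOn {A} Q = ∀ {P : A → Set} → (∀ a → Dec (P a)) → Dec (∃ λ a → Q a × P a)

search-≤ : ∀ k → SearchOn (_≤ k)
search-≤ k P? = map′ (λ (i , i<1+k , p) → i , ≤-pred i<1+k , p) (λ (i , i≤k , p) → i , s≤s i≤k , p) (anyUpTo? P? (suc k))

search-Fin : ∀ {n} → SearchOn {Fin n} (λ _ → ⊤)
search-Fin P? = map′ (λ (x , p) → x , tt , p) (λ (x , _ , p) → x , p) (Fin.any? P?)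

search-List : {A : Set} {Q : A → Set} → SearchOn Q → ∀ k → SearchOn (λ xs → length xs ≤ k × All Q xs)
search-List s zero P? = map′ (λ p → [] , (z≤n , []) , p) (λ { ([] , _ , p) → p }) (P? [])
search-List {A} {Q} s (suc k) {P} P? = map′ to from
  (P? [] ⊎-dec s λ x → search-List s k λ xs → P? (x ∷ xs))
  where
  to : P [] ⊎ (∃ λ x → Q x × ∃ λ xs → (length xs ≤ k × All Q xs) × P (x ∷ xs)) → ∃ λ xs → (length xs ≤ suc k × All Q xs) × P xs
  to (inj₁ p) = [] , (z≤n , []) , p
  to (inj₂ (x , q , xs , (l , qs) , p)) = x ∷ xs , (s≤s l , q ∷ qs) , p
  from : (∃ λ xs → (length xs ≤ suc k × All Q xs) × P xs) → P [] ⊎ (∃ λ x → Q x × ∃ λ xs → (length xs ≤ k × All Q xs) × P (x ∷ xs))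
  from ([] , _ , p) = inj₁ p
  from (x ∷ xs , (s≤s l , q ∷ qs) , p) = inj₂ (x , q , xs , (l , qs) , p)

greatest : {P : ℕ → Set} → (∀ i → Dec (P i)) → ∀ {a} → P a → ∀ b → (∀ {i} → P i → i ≤ b) →
  ∃ λ m → P m × (∀ {i} → P i → i ≤ m)
greatest P? pa b bound with P? b
... | yes pb = b , pb , bound
greatest P? pa zero bound | no ¬p with bound pa
... | z≤n = ⊥-elim (¬p pa)
greatest P? pa (suc b) bound | no ¬p = greatest P? pa b λ pi → ≤-pred (≤∧≢⇒< (bound pi) λ { refl → ¬p pi })

least : {P : ℕ → Set} → (∀ i → Dec (P i)) → ∀ fuel {b} → P b → b ≤ fuel → ∃ λ m → P m × (∀ i → P i → m ≤ i)
least P? fuel {b} pb b≤ with anyUpTo? P? b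
... | no none = b , pb , λ i pi → ≮⇒≥ λ i<b → none (i , i<b , pi)
least P? zero pb z≤n | yes (_ , () , _)
least P? (suc fuel) pb b≤ | yes (m , m<b , pm) = least P? fuel pm (≤-pred (≤-trans m<b b≤))

module _ {n : ℕ} (H : Graph (Fin n)) where

  -- Stars stripped of their proofs, so that the search runs over plain data.
  StarData : Set
  StarData = Fin n × List (Fin n)

  IsStar : StarData → Set
  IsStar (x , ls) = 1 ≤ length ls × length ls ≤ 4 × All (λ l → adj H x l ≡ true) ls

  search-Star : SearchOn IsStar
  search-Star P? = map′
    (λ (x , _ , ls , (l≤4 , _) , (1≤l , es) , p) → (x , ls) , (1≤l , l≤4 , es) , p)
    (λ ((x , ls) , (1≤l , l≤4 , es) , p) → x , tt , ls , (l≤4 , All.universal _ ls) , (1≤l , es) , p)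
    (search-Fin λ x → search-List search-Fin 4 λ ls →
      ((1 ≤? length ls) ×-dec all? (λ l → adj H x l Bool.≟ true) ls) ×-dec P? (x , ls))

  verts : List StarData → List (Fin n)
  verts = concatMap λ (x , ls) → x ∷ ls

  toStars : ∀ {ds} → All IsStar ds → Σ (List (Star H)) λ ss → concatMap starVerts ss ≡ verts ds
  toStars [] = [] , refl
  toStars {(x , ls) ∷ _} ((1≤l , l≤4 , es) ∷ ps) = let (ss , e) = toStars ps in
    record { center = x ; leaves = ls ; atLeast = 1≤l ; atMost = l≤4 ; edges = es } ∷ ss , cong ((x ∷ ls) ++_) e

  fromStars : (ss : List (Star H)) → Σ (List StarData) λ ds → All IsStar ds × concatMap starVerts ss ≡ verts ds
  fromStars [] = [] , [] , refl
  fromStars (s ∷ ss) = let (ds , ps , e) = fromStars ss in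
    (center s , leaves s) ∷ ds , (atLeast s , atMost s , edges s) ∷ ps , cong (starVerts s ++_) e

  length-verts : ∀ ds → length ds ≤ length (verts ds)
  length-verts [] = z≤n
  length-verts ((x , ls) ∷ ds) = s≤s (≤-trans (≤-trans (length-verts ds) (m≤n+m _ (length ls))) (≤-reflexive (≡-sym (length-++ ls))))

  unique⇒length≤ : {xs : List (Fin n)} → Unique xs → length xs ≤ n
  unique⇒length≤ u = ≤-trans (unique-⊆-length u (λ {x} _ → ∈-allFin x)) (≤-reflexive (length-tabulate id))

  hasOrder? : ∀ s → Dec (Σ (FourStarMatching H) λ m → order m ≡ s)
  -- Disjoint stars have distinct centres, so lists of at most `n` stars exhaust all matchings.
  hasOrder? s = map′ to from (search-List search-Star n λ ds → DecUnique.unique? _≟_ (verts ds) ×-dec (length (verts ds) ℕ.≟ s))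
    where
    to : (∃ λ ds → (length ds ≤ n × All IsStar ds) × Unique (verts ds) × length (verts ds) ≡ s) → Σ (FourStarMatching H) λ m → order m ≡ s
    to (ds , (_ , ps) , u , len) = let (ss , e) = toStars ps in
      (ss , subst Unique (≡-sym e) u) , trans (cong length e) len
    from : (Σ (FourStarMatching H) λ m → order m ≡ s) → ∃ λ ds → (length ds ≤ n × All IsStar ds) × Unique (verts ds) × length (verts ds) ≡ s
    from ((ss , u) , len) = let (ds , ps , e) = fromStars ss in let u' = subst Unique e u in
      ds , (≤-trans (length-verts ds) (unique⇒length≤ u') , ps) , u' , trans (cong length (≡-sym e)) len

  s4-exists : ∃ (IsS4 H)
  s4-exists with greatest hasOrder? (([] , []) , refl) n (λ { ((_ , u) , refl) → unique⇒length≤ u })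
  ... | s , has , max = s , has , λ m → max (m , refl)

module FiniteSpan {V : Set} (_≟V_ : DecidableEquality V) (K : Graph V) (vs : List V) (complete : ∀ v → v ∈ vs) where

  open Finite complete

  isL21? : ∀ f → Dec (IsL21 K f)
  isL21? f = (∀? λ x → ∀? λ y → (adj K x y Bool.≟ true) →-dec (2 ≤? ∣ f x - f y ∣))
    ×-dec (∀? λ x → ∀? λ y → (¬? (x ≟V y) ×-dec (adj K x y Bool.≟ false) ×-dec
      ∃? λ z → (adj K x z Bool.≟ true) ×-dec (adj K z y Bool.≟ true)) →-dec ¬? (f x ℕ.≟ f y))

  -- Turns a list of values along the vertices into a labeling, 0 by default, so that bounded
  -- labelings form a finite search space.
  read : List V → List ℕ → V → ℕ
  read (w ∷ ws) (l ∷ ls) v with w ≟V v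
  ... | yes _ = l
  ... | no  _ = read ws ls v
  read _ _ _ = 0

  read-map : ∀ (f : V → ℕ) {ws v} → v ∈ ws → read ws (map f ws) v ≡ f v
  read-map f {w ∷ _} {v} v∈ with w ≟V v
  ... | yes refl = refl
  read-map f (here refl) | no p = ⊥-elim (p refl)
  read-map f (there v∈)  | no _ = read-map f v∈

  hasSpan? : ∀ k → Dec (HasSpan K k)
  hasSpan? k = map′ (λ (ls , _ , p) → read vs ls , p) from
    (search-List (search-≤ k) (length vs) λ ls → isL21? (read vs ls) ×-dec ∀? λ v → read vs ls v ≤? k)
    where
    from : HasSpan K k → ∃ λ ls → (length ls ≤ length vs × All (_≤ k) ls) × IsL21 K (read vs ls) × (∀ v → read vs ls v ≤ k)
    from (f , (d1 , d2) , bound) = map f vs , (≤-reflexive (length-map f vs) , All.map⁺ (All.universal bound vs)) ,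
      ( (λ x y xy → subst (2 ≤_) (cong₂ ∣_-_∣ (≡-sym (eq x)) (≡-sym (eq y))) (d1 x y xy))
      , (λ x y xy e → d2 x y xy (trans (≡-sym (eq x)) (trans e (eq y)))) )
      , λ v → subst (_≤ k) (≡-sym (eq v)) (bound v)
      where
      eq : ∀ v → read vs (map f vs) v ≡ f v
      eq v = read-map f (complete v)

-- Halving the deficiency, and the value of lambda.

⌈/2⌉-≤⁺ : ∀ i m → i ≤ 2 * m → ⌈ i /2⌉ ≤ m
⌈/2⌉-≤⁺ zero m _ = z≤n
⌈/2⌉-≤⁺ (suc zero) (suc m) _ = s≤s z≤n
⌈/2⌉-≤⁺ (suc (suc i)) (suc m) (s≤s le) = s≤s (⌈/2⌉-≤⁺ i m (≤-pred (subst (suc i ≤_) (+-suc m (m + 0)) le)))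

⌈/2⌉-≤⁻ : ∀ i m → ⌈ i /2⌉ ≤ m → i ≤ 2 * m
⌈/2⌉-≤⁻ zero m _ = z≤n
⌈/2⌉-≤⁻ (suc zero) (suc m) _ = s≤s z≤n
⌈/2⌉-≤⁻ (suc (suc i)) (suc m) (s≤s le) = s≤s (subst (suc i ≤_) (≡-sym (+-suc m (m + 0))) (s≤s (⌈/2⌉-≤⁻ i m le)))

span-mono : {V : Set} {K : Graph V} {k m : ℕ} → k ≤ m → HasSpan K k → HasSpan K m
span-mono k≤m (f , l21 , bound) = f , l21 , λ v → ≤-trans (bound v) k≤m

module _ {n : ℕ} (G : Graph (Fin n)) {s : ℕ} (isS4 : IsS4 (compl G) s) where

  span⇒deficiency : ∀ r → HasSpan (M G) (2 * n + r) → n ∸ s ≤ 2 * r + 4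
  span⇒deficiency r sp = let (m , le) = span⇒matching G r sp in
    m≤n+o⇒m∸n≤o n s (≤-trans le (+-monoˡ-≤ _ (proj₂ isS4 m)))

  deficiency⇒span : ∀ r → n ∸ s ≤ 2 * r + 4 → HasSpan (M G) (2 * n + r)
  deficiency⇒span r le = let ((m , e) , _) = isS4 in
    Construction.matching⇒span G r m (subst (λ t → n ≤ t + (2 * r + 4)) (≡-sym e) (≤-trans (m≤n+m∸n n s) (+-monoʳ-≤ s le)))

  private
    double : ∀ r → 2 * (r + 2) ≡ 2 * r + 4
    double r = *-distribˡ-+ 2 r 2

  span⇒⌈/2⌉ : ∀ r → HasSpan (M G) (2 * n + r) → ⌈ n ∸ s /2⌉ ≤ r + 2
  span⇒⌈/2⌉ r sp = ⌈/2⌉-≤⁺ _ (r + 2) (subst (n ∸ s ≤_) (≡-sym (double r)) (span⇒deficiency r sp))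

  ⌈/2⌉⇒span : ∀ r → ⌈ n ∸ s /2⌉ ≤ r + 2 → HasSpan (M G) (2 * n + r)
  ⌈/2⌉⇒span r le = deficiency⇒span r (subst (n ∸ s ≤_) (double r) (⌈/2⌉-≤⁻ _ (r + 2) le))

  -- The deficiency is at most `n`, so `r = n` always admits a labeling; the least span is then
  -- found by search below `2n + n`.
  lambda-exists : ∃ (IsLambda (M G))
  lambda-exists = least (FiniteSpan.hasSpan? _≟MV_ (M G) (vertices n) vertices-complete) _
    (deficiency⇒span n (≤-trans (m∸n≤m n s) (≤-trans (m≤m+n n (n + 0)) (m≤m+n (2 * n) 4)))) ≤-refl

  -- For `r = q + 1`, `lam` is `2n + r` exactly when span `2n + r` is possible and span `2n + q` is
  -- not; these two thresholds are the bounds `r + 2` and `q + 2` on the rounded half of the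
  -- deficiency.
  lambda⇔⌈/2⌉ : ∀ {lam} → IsLambda (M G) lam → ∀ r → 1 ≤ r → lam ≡ 2 * n + r ⇔ ⌈ n ∸ s /2⌉ ≡ r + 2
  lambda⇔⌈/2⌉ {lam} (has , minimal) (suc q) _ = mk⇔ to from
    where
    to : lam ≡ 2 * n + suc q → ⌈ n ∸ s /2⌉ ≡ suc q + 2
    to refl = ≤-antisym (span⇒⌈/2⌉ (suc q) has) (≰⇒> λ le →
      <⇒≱ (+-monoʳ-< (2 * n) (n<1+n q)) (minimal _ (⌈/2⌉⇒span q le)))
    from : ⌈ n ∸ s /2⌉ ≡ suc q + 2 → lam ≡ 2 * n + suc q
    from e = ≤-antisym (minimal _ (⌈/2⌉⇒span (suc q) (≤-reflexive e))) (≮⇒≥ λ lam< →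
      <⇒≢ (s≤s (span⇒⌈/2⌉ q (span-mono {K = M G} (≤-pred (subst (lam <_) (+-suc (2 * n) q) lam<)) has))) e)

theorem3p4 : (n : ℕ) (G : Graph (Fin n)) →
    Σ ℕ λ lam → Σ ℕ λ s4 →
    IsLambda (M G) lam × IsS4 (compl G) s4 ×
    ((HasSpan (M G) (2 * n) ⇔ (n ∸ s4 ≤ 4)) ×
    (∀ (r : ℕ) → 1 ≤ r → (lam ≡ 2 * n + r ⇔ ⌈ n ∸ s4 /2⌉ ≡ r + 2)))
theorem3p4 n G with s4-exists (compl G)
... | s , isS4 with lambda-exists G isS4
...   | lam , isLambda = lam , s , isLambda , isS4 ,
  -- Part (a) is the deficiency criterion at `r = 0`.
  mk⇔ (span⇒deficiency G isS4 0 ∘ subst (HasSpan (M G)) (≡-sym (+-identityʳ (2 * n))))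
      (subst (HasSpan (M G)) (+-identityʳ (2 * n)) ∘ deficiency⇒span G isS4 0) ,
  lambda⇔⌈/2⌉ G isS4 isLambda
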